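{- For integers $A,B\ge0$ put $J_{A,B}(t)=\sum_{k\ge0}\binom{A}{k}\binom{B}{k}t^k$. Fix an integer $\kappa\ge0$, and for $n\ge1$ write $J_{n,n+\kappa}(t)=\prod_{j=1}^{n}(t-\zeta_{n,\kappa,j})$ up to its positive leading factor, with $\zeta_{n,\kappa,1}<\cdots<\zeta_{n,\kappa,n}<0$ (so $J_{n,n+\kappa}$ has $n$ distinct negative real zeros). Then for every $n\ge1$ the zeros of $J_{n,n+\kappa}$ and $J_{n+1,n+1+\kappa}$ strictly interlace on $(-\infty,0)$: $$\zeta_{n+1,\kappa,1}<\zeta_{n,\kappa,1}<\zeta_{n+1,\kappa,2}<\cdots<\zeta_{n,\kappa,n}<\zeta_{n+1,\kappa,n+1}.$$ -}

module Defs where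

open import Algebra.Bundles using (RawSemiring)
open import Data.Fin.Base as Fin using (Fin; toℕ)
open import Data.Nat.Base as ℕ using (ℕ; suc)
import Data.Nat.Properties as ℕ
open import Data.Nat.Combinatorics using (_C_)
open import Data.Product.Base using (∃-syntax; _×_; _,_)
open import Data.Rational.Base as ℚ using (ℚ; 0ℚ; 1ℚ; ½; ∣_∣)
import Data.Rational.Properties as ℚ
open import Data.Rational.Solver using (module +-*-Solver)
open import Data.Vec.Functional using (Vector)
open import Level using (0ℓ)
open import Relation.Binary.PropositionalEquality
  using (_≡_; refl; sym; trans; cong; subst)

------------------------------------------------------------------------
-- Real numbers: Cauchy sequences of rationals, with equality ≃ meaning
-- that the difference is a null sequence.

IsCauchy : (ℕ → ℚ) → Set
IsCauchy x = ∀ ε → 0ℚ ℚ.< ε →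
  ∃[ N ] (∀ m n → N ℕ.≤ m → N ℕ.≤ n → ∣ x m ℚ.- x n ∣ ℚ.< ε)

record ℝ : Set where
  constructor mkℝ
  field
    seq    : ℕ → ℚ
    cauchy : IsCauchy seq

open ℝ public

infix 4 _≃_ _<_

_≃_ : ℝ → ℝ → Set
x ≃ y = ∀ ε → 0ℚ ℚ.< ε →
  ∃[ N ] (∀ n → N ℕ.≤ n → ∣ seq x n ℚ.- seq y n ∣ ℚ.< ε)

-- The gap ε has to be uniform: eventual termwise inequality alone would
-- relate sequences with the same limit.
_<_ : ℝ → ℝ → Set
x < y = ∃[ ε ] (0ℚ ℚ.< ε ×
  ∃[ N ] (∀ n → N ℕ.≤ n → seq x n ℚ.+ ε ℚ.< seq y n))

-- Abstract because unfolding these proofs is very slow.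
abstract
  module _ where
    open +-*-Solver

    add-subtract : ∀ a b → a ≡ (a ℚ.- b) ℚ.+ b
    add-subtract = solve 2 (λ a b → a := (a :- b) :+ b) refl

    +-difference : ∀ a b c d →
      (a ℚ.+ b) ℚ.- (c ℚ.+ d) ≡ (a ℚ.- c) ℚ.+ (b ℚ.- d)
    +-difference = solve 4 (λ a b c d →
      (a :+ b) :- (c :+ d) := (a :- c) :+ (b :- d)) refl

    *-difference : ∀ a b c d →
      a ℚ.* b ℚ.- c ℚ.* d ≡ a ℚ.* (b ℚ.- d) ℚ.+ d ℚ.* (a ℚ.- c)
    *-difference = solve 4 (λ a b c d →
      a :* b :- c :* d := a :* (b :- d) :+ d :* (a :- c)) refl

  pos*pos : ∀ {p q} → 0ℚ ℚ.< p → 0ℚ ℚ.< q → 0ℚ ℚ.< p ℚ.* q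
  pos*pos {p} {q} 0<p 0<q =
    subst (ℚ._< p ℚ.* q) (ℚ.*-zeroʳ p)
      (ℚ.*-monoʳ-<-pos p {{ℚ.positive 0<p}} 0<q)

  ½+½ : ∀ ε → ε ℚ.* ½ ℚ.+ ε ℚ.* ½ ≡ ε
  ½+½ ε = trans (sym (ℚ.*-distribˡ-+ ε ½ ½)) (ℚ.*-identityʳ ε)

  m⊔n≤o⇒ : ∀ {m n o} → m ℕ.⊔ n ℕ.≤ o → m ℕ.≤ o × n ℕ.≤ o
  m⊔n≤o⇒ {m} {n} p = ℕ.m⊔n≤o⇒m≤o m n p , ℕ.m⊔n≤o⇒n≤o m n p

  mul-bound : ∀ {p b d δ} → ∣ p ∣ ℚ.< b → ∣ d ∣ ℚ.< δ → ∣ p ℚ.* d ∣ ℚ.< b ℚ.* δ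
  mul-bound {p} {b} {d} {δ} p<b d<δ = begin-strict
    ∣ p ℚ.* d ∣      ≡⟨ ℚ.∣p*q∣≡∣p∣*∣q∣ p d ⟩
    ∣ p ∣ ℚ.* ∣ d ∣  ≤⟨ ℚ.*-monoˡ-≤-nonNeg ∣ p ∣ {{ℚ.nonNegative (ℚ.0≤∣p∣ p)}} (ℚ.<⇒≤ d<δ) ⟩
    ∣ p ∣ ℚ.* δ      <⟨ ℚ.*-monoˡ-<-pos δ {{ℚ.positive (ℚ.≤-<-trans (ℚ.0≤∣p∣ d) d<δ)}} p<b ⟩
    b ℚ.* δ          ∎
    where open ℚ.≤-Reasoning

  const-cauchy : ∀ q → IsCauchy (λ _ → q)
  const-cauchy q ε 0<ε = 0 , λ _ _ _ _ →
    subst (λ r → ∣ r ∣ ℚ.< ε) (sym (ℚ.+-inverseʳ q)) 0<ε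

  neg-cauchy : ∀ {x} → IsCauchy x → IsCauchy (λ n → ℚ.- x n)
  neg-cauchy {x} cx ε 0<ε with cx ε 0<ε
  ... | N , h = N , λ m n N≤m N≤n →
    subst (ℚ._< ε)
      (trans (sym (ℚ.∣-p∣≡∣p∣ (x m ℚ.- x n))) (cong ∣_∣ (ℚ.neg-distrib-+ (x m) (ℚ.- x n))))
      (h m n N≤m N≤n)

  +-cauchy : ∀ {x y} → IsCauchy x → IsCauchy y → IsCauchy (λ n → x n ℚ.+ y n)
  +-cauchy {x} {y} cx cy ε 0<ε
    with cx (ε ℚ.* ½) (pos*pos 0<ε (ℚ.positive⁻¹ ½)) | cy (ε ℚ.* ½) (pos*pos 0<ε (ℚ.positive⁻¹ ½))
  ... | M , f | N , g = M ℕ.⊔ N , bound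
    where
    open ℚ.≤-Reasoning
    bound : ∀ m n → M ℕ.⊔ N ℕ.≤ m → M ℕ.⊔ N ℕ.≤ n →
            ∣ (x m ℚ.+ y m) ℚ.- (x n ℚ.+ y n) ∣ ℚ.< ε
    bound m n p q with m⊔n≤o⇒ {M} p | m⊔n≤o⇒ {M} q
    ... | M≤m , N≤m | M≤n , N≤n = begin-strict
      ∣ (x m ℚ.+ y m) ℚ.- (x n ℚ.+ y n) ∣    ≡⟨ cong ∣_∣ (+-difference (x m) (y m) (x n) (y n)) ⟩
      ∣ (x m ℚ.- x n) ℚ.+ (y m ℚ.- y n) ∣    ≤⟨ ℚ.∣p+q∣≤∣p∣+∣q∣ (x m ℚ.- x n) (y m ℚ.- y n) ⟩
      ∣ x m ℚ.- x n ∣ ℚ.+ ∣ y m ℚ.- y n ∣    <⟨ ℚ.+-mono-< (f m n M≤m M≤n) (g m n N≤m N≤n) ⟩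
      ε ℚ.* ½ ℚ.+ ε ℚ.* ½                    ≡⟨ ½+½ ε ⟩
      ε                                      ∎

  cauchy-bound : ∀ {x} → IsCauchy x →
    ∃[ b ] (0ℚ ℚ.< b × ∃[ N ] (∀ n → N ℕ.≤ n → ∣ x n ∣ ℚ.< b))
  cauchy-bound {x} cx with cx 1ℚ (ℚ.positive⁻¹ 1ℚ)
  ... | N , h = 1ℚ ℚ.+ ∣ x N ∣
              , ℚ.+-mono-<-≤ (ℚ.positive⁻¹ 1ℚ) (ℚ.0≤∣p∣ (x N))
              , N , bound
    where
    open ℚ.≤-Reasoning
    bound : ∀ n → N ℕ.≤ n → ∣ x n ∣ ℚ.< 1ℚ ℚ.+ ∣ x N ∣
    bound n N≤n = begin-strict
      ∣ x n ∣                         ≡⟨ cong ∣_∣ (add-subtract (x n) (x N)) ⟩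
      ∣ (x n ℚ.- x N) ℚ.+ x N ∣       ≤⟨ ℚ.∣p+q∣≤∣p∣+∣q∣ (x n ℚ.- x N) (x N) ⟩
      ∣ x n ℚ.- x N ∣ ℚ.+ ∣ x N ∣     <⟨ ℚ.+-monoˡ-< ∣ x N ∣ (h n N N≤n ℕ.≤-refl) ⟩
      1ℚ ℚ.+ ∣ x N ∣                  ∎

  divide : ∀ c → 0ℚ ℚ.< c → ∀ ε → 0ℚ ℚ.< ε → ∃[ δ ] (0ℚ ℚ.< δ × c ℚ.* δ ≡ ε)
  divide c 0<c ε 0<ε = c⁻¹ ℚ.* ε , pos*pos 0<c⁻¹ 0<ε , inverse
    where
    instance
      c-positive : ℚ.Positive c
      c-positive = ℚ.positive 0<c

      c-nonZero : ℚ.NonZero c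
      c-nonZero = ℚ.pos⇒nonZero c

    c⁻¹ : ℚ
    c⁻¹ = ℚ.1/ c

    0<c⁻¹ : 0ℚ ℚ.< c⁻¹
    0<c⁻¹ = ℚ.positive⁻¹ c⁻¹ {{ℚ.1/pos⇒pos c}}

    inverse : c ℚ.* (c⁻¹ ℚ.* ε) ≡ ε
    inverse = trans (sym (ℚ.*-assoc c c⁻¹ ε))
             (trans (cong (ℚ._* ε) (ℚ.*-inverseʳ c)) (ℚ.*-identityˡ ε))

  *-close : ∀ {p q r s a b δ} → ∣ p ∣ ℚ.< a → ∣ s ∣ ℚ.< b →
            ∣ p ℚ.- r ∣ ℚ.< δ → ∣ q ℚ.- s ∣ ℚ.< δ →
            ∣ p ℚ.* q ℚ.- r ℚ.* s ∣ ℚ.< (a ℚ.+ b) ℚ.* δ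
  *-close {p} {q} {r} {s} {a} {b} {δ} p<a s<b pr qs = begin-strict
    ∣ p ℚ.* q ℚ.- r ℚ.* s ∣                          ≡⟨ cong ∣_∣ (*-difference p q r s) ⟩
    ∣ p ℚ.* (q ℚ.- s) ℚ.+ s ℚ.* (p ℚ.- r) ∣          ≤⟨ ℚ.∣p+q∣≤∣p∣+∣q∣ (p ℚ.* (q ℚ.- s)) (s ℚ.* (p ℚ.- r)) ⟩
    ∣ p ℚ.* (q ℚ.- s) ∣ ℚ.+ ∣ s ℚ.* (p ℚ.- r) ∣      <⟨ ℚ.+-mono-< (mul-bound {p} p<a qs) (mul-bound {s} s<b pr) ⟩
    a ℚ.* δ ℚ.+ b ℚ.* δ                              ≡⟨ ℚ.*-distribʳ-+ δ a b ⟨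
    (a ℚ.+ b) ℚ.* δ                                  ∎
    where open ℚ.≤-Reasoning

  *-cauchy : ∀ {x y} → IsCauchy x → IsCauchy y → IsCauchy (λ n → x n ℚ.* y n)
  *-cauchy {x} {y} cx cy ε 0<ε =
    let a , 0<a , A , x<a = cauchy-bound {x} cx
        b , 0<b , B , y<b = cauchy-bound {y} cy
        δ , 0<δ , eq      = divide (a ℚ.+ b) (ℚ.+-mono-< 0<a 0<b) ε 0<ε
        M , f             = cx δ 0<δ
        N , g             = cy δ 0<δ
    in (A ℕ.⊔ B) ℕ.⊔ (M ℕ.⊔ N) , λ m n p q →
      let AB≤m , MN≤m = m⊔n≤o⇒ {A ℕ.⊔ B} {M ℕ.⊔ N} p
          AB≤n , MN≤n = m⊔n≤o⇒ {A ℕ.⊔ B} {M ℕ.⊔ N} q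
          A≤m  , _    = m⊔n≤o⇒ {A} {B} AB≤m
          _    , B≤n  = m⊔n≤o⇒ {A} {B} AB≤n
          M≤m  , N≤m  = m⊔n≤o⇒ {M} {N} MN≤m
          M≤n  , N≤n  = m⊔n≤o⇒ {M} {N} MN≤n
      in subst (∣ x m ℚ.* y m ℚ.- x n ℚ.* y n ∣ ℚ.<_) eq
           (*-close {x m} {y m} {x n} {y n} {a} {b} {δ}
             (x<a m A≤m) (y<b n B≤n) (f m n M≤m M≤n) (g m n N≤m N≤n))

fromℚ : ℚ → ℝ
fromℚ q = mkℝ (λ _ → q) (const-cauchy q)

0ℝ 1ℝ : ℝ
0ℝ = fromℚ 0ℚ
1ℝ = fromℚ 1ℚ

infix  8 -_
infixl 7 _*_
infixl 6 _+_ _-_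

-_ : ℝ → ℝ
- x = mkℝ (λ n → ℚ.- seq x n) (neg-cauchy {seq x} (cauchy x))

_+_ _*_ _-_ : ℝ → ℝ → ℝ
x + y = mkℝ (λ n → seq x n ℚ.+ seq y n) (+-cauchy {seq x} {seq y} (cauchy x) (cauchy y))
x * y = mkℝ (λ n → seq x n ℚ.* seq y n) (*-cauchy {seq x} {seq y} (cauchy x) (cauchy y))
x - y = x + (- y)

ℝ-rawSemiring : RawSemiring 0ℓ 0ℓ
ℝ-rawSemiring = record
  { Carrier = ℝ
  ; _≈_     = _≃_
  ; _+_     = _+_
  ; _*_     = _*_
  ; 0#      = 0ℝ
  ; 1#      = 1ℝ
  }

open import Algebra.Definitions.RawSemiring ℝ-rawSemiring public
  using (sum; product; _^_)
  renaming (_×_ to infixr 8 _·_)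

------------------------------------------------------------------------
-- J A B t = Σₖ (A choose k)(B choose k) tᵏ.  The sum is truncated at
-- k = A because A C k is 0 for larger k; m · x is the m-fold sum of x.

J : ℕ → ℕ → ℝ → ℝ
J A B t = sum {n = suc A} (λ k → ((A C toℕ k) ℕ.* (B C toℕ k)) · (t ^ toℕ k))

-- ζ lists the zeros of J n (n + κ) in increasing order.  An identity
-- between polynomials is expressed by equality of values at every real t.
record IsZeros (κ n : ℕ) (ζ : Vector ℝ n) : Set where
  field
    increasing    : ∀ i j → i Fin.< j → ζ i < ζ j
    negative      : ∀ j → ζ j < 0ℝ
    lead          : ℝ
    lead-positive : 0ℝ < lead
    factorisation : ∀ t → J n (n ℕ.+ κ) t ≃ lead * product (λ j → t - ζ j)

-- The indices j of ζ and inject₁ j, suc j of ξ stand for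
-- ξⱼ < ζⱼ < ξⱼ₊₁ with 1 ≤ j ≤ n.
StrictlyInterlace : ∀ {n} → Vector ℝ n → Vector ℝ (suc n) → Set
StrictlyInterlace {n} ζ ξ = ∀ (j : Fin n) → ξ (Fin.inject₁ j) < ζ j × ζ j < ξ (Fin.suc j)

{-# OPTIONS --safe #-}

-- Contiguous relations of J give constants with
--   k₊ Jₙ₊₁ + k₋ (1 − t)² Jₙ₋₁ = (linear polynomial) Jₙ,   k₊, k₋ > 0,
-- so at a zero of Jₙ the polynomials Jₙ₊₁ and Jₙ₋₁ have opposite signs.  If
-- the zeros of Jₙ₋₁ and Jₙ interlace, Jₙ₋₁ alternates in sign along the
-- zeros of Jₙ, hence so does Jₙ₊₁, and together with its signs near −∞ and
-- at 0 this puts exactly one zero of Jₙ₊₁ in each gap.  Constructively,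
-- the endpoints of the gaps are first replaced by nearby rationals, where
-- signs are decidable, so that bisection applies; and a factor of a product
-- bounded away from 0 has a sign of its own, so that the gaps in which given
-- zeros lie can be determined.
module Submission where

open import Algebra.Bundles using (CommutativeRing)
import Algebra.Properties.Semiring.Mult as SemiringMult
open import Data.Empty using (⊥-elim)
open import Data.Fin.Base as Fin using (Fin; zero; suc; toℕ; inject₁; fromℕ)
import Data.Fin.Properties as Fin
import Data.Integer.Base as ℤ
import Data.Integer.Properties as ℤ
open import Data.Nat.Base as ℕ using (ℕ; zero; suc; _≤_; z≤n; s≤s)
open import Data.Nat.Combinatorics
  using (_C_; k>n⇒nCk≡0; nCk≡nC[n∸k]; nCn≡1; nC1≡n; nCk+nC[k+1]≡[n+1]C[k+1])
import Data.Nat.Properties as ℕ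
import Data.Nat.Solver as ℕSolver
open import Data.Product.Base using (∃-syntax; _×_; _,_; proj₁; proj₂)
open import Data.Rational.Base as ℚ using (ℚ; 0ℚ; 1ℚ; ½; ∣_∣)
import Data.Rational.Properties as ℚ
open import Data.Rational.Solver using (module +-*-Solver)
import Data.Rational.Unnormalised.Base as ℚᵘ
import Data.Rational.Unnormalised.Properties as ℚᵘ
open import Data.Sign.Base as Sign using (Sign; opposite)
import Data.Sign.Properties as Sign
open import Data.Sum.Base using (_⊎_; inj₁; inj₂)
open import Data.Vec.Functional using (Vector; tail; insertAt; _∷_)
open import Function.Base using (_∘_)
open import Level using (0ℓ)
open import Relation.Binary.Bundles using (Setoid)
open import Relation.Binary.PropositionalEquality
  using (_≡_; refl; sym; trans; cong; cong₂; subst; subst₂; module ≡-Reasoning)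
import Relation.Binary.Reasoning.Setoid as SetoidReasoning
open import Relation.Nullary using (yes; no)
open import Defs

-- Real numbers

-- The induction carries signs rather than the interlacing itself. For increasing lists, interlacing
-- is equivalent to an alternating sign pattern of a product of differences, and signs can be moved
-- through the recurrence. The same equivalence reaches arbitrary lists of zeros: bisection produces
-- only one such list, while the theorem speaks of any `ζ` and `ξ` satisfying `IsZeros`, so
-- interlacing is derived from the factorisation and never from the way in which zeros were found.
-- Having a sign means being bounded away from 0 from some index on. This cannot be tested for a
-- real number, so every such bound is inherited: from a strict inequality, from a rational value,
-- or from a product or a vanishing sum whose other parts are controlled. The induction starts at n
-- = 0, where J is the constant 1 and alternation at the empty list of zeros is vacuous.

Eventually : (ℕ → Set) → Set
Eventually P = ∃[ N ] (∀ n → N ≤ n → P n)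

module _ {P Q : ℕ → Set} where

  eventually-map : (∀ n → P n → Q n) → Eventually P → Eventually Q
  eventually-map f (N , h) = N , λ n N≤n → f n (h n N≤n)

  eventually-zip : {R : ℕ → Set} → (∀ n → P n → Q n → R n) →
                   Eventually P → Eventually Q → Eventually R
  eventually-zip f (M , g) (N , h) = M ℕ.⊔ N , λ n M⊔N≤n →
    f n (g n (ℕ.m⊔n≤o⇒m≤o M N M⊔N≤n)) (h n (ℕ.m⊔n≤o⇒n≤o M N M⊔N≤n))

eventually-∀ : ∀ {m} {P : Fin m → ℕ → Set} → (∀ j → Eventually (P j)) →
               Eventually (λ n → ∀ j → P j n)
eventually-∀ {zero}  h = 0 , λ _ _ ()
eventually-∀ {suc m} h =
  eventually-zip (λ { n p q zero → p ; n p q (suc j) → q j }) (h zero) (eventually-∀ (h ∘ suc))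

module _ where
  open +-*-Solver

  opaque
    p+q-p≡q : ∀ p q → (p ℚ.+ q) ℚ.- p ≡ q
    p+q-p≡q = solve 2 (λ p q → (p :+ q) :- p := q) refl

    p+[q-p]≡q : ∀ p q → p ℚ.+ (q ℚ.- p) ≡ q
    p+[q-p]≡q = solve 2 (λ p q → p :+ (q :- p) := q) refl

    q-p≡-[p-q] : ∀ p q → q ℚ.- p ≡ ℚ.- (p ℚ.- q)
    q-p≡-[p-q] = solve 2 (λ p q → q :- p := :- (p :- q)) refl

    telescope : ∀ p q r → p ℚ.- r ≡ (p ℚ.- q) ℚ.+ (q ℚ.- r)
    telescope = solve 3 (λ p q r → p :- r := (p :- q) :+ (q :- r)) refl

    neg-involutive : ∀ p → ℚ.- (ℚ.- p) ≡ p
    neg-involutive = solve 1 (λ p → :- (:- p) := p) refl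

    neg-*-neg : ∀ p q → p ℚ.* q ≡ ℚ.- p ℚ.* ℚ.- q
    neg-*-neg = solve 2 (λ p q → p :* q := :- p :* :- q) refl

    p≡p-0 : ∀ p → p ≡ p ℚ.- 0ℚ
    p≡p-0 = solve 1 (λ p → p := p :- con 0ℚ) refl

opaque
  +-cancelˡ-< : ∀ r {p q} → r ℚ.+ p ℚ.< r ℚ.+ q → p ℚ.< q
  +-cancelˡ-< r {p} {q} lt =
    subst₂ ℚ._<_ (p+q-p≡q r p) (p+q-p≡q r q) (ℚ.+-monoˡ-< (ℚ.- r) lt)

  p+ε<q⇒ε<q-p : ∀ {p q ε} → p ℚ.+ ε ℚ.< q → ε ℚ.< q ℚ.- p
  p+ε<q⇒ε<q-p {p} {q} lt = +-cancelˡ-< p (subst (_ ℚ.<_) (sym (p+[q-p]≡q p q)) lt)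

  ε<q-p⇒p+ε<q : ∀ {p q ε} → ε ℚ.< q ℚ.- p → p ℚ.+ ε ℚ.< q
  ε<q-p⇒p+ε<q {p} {q} lt = subst (_ ℚ.<_) (p+[q-p]≡q p q) (ℚ.+-monoʳ-< p lt)

  0<ε*½ : ∀ {ε} → 0ℚ ℚ.< ε → 0ℚ ℚ.< ε ℚ.* ½
  0<ε*½ 0<ε = pos*pos 0<ε (ℚ.positive⁻¹ ½)

  p<p+ε : ∀ {p ε} → 0ℚ ℚ.< ε → p ℚ.< p ℚ.+ ε
  p<p+ε {p} {ε} 0<ε = subst (ℚ._< p ℚ.+ ε) (ℚ.+-identityʳ p) (ℚ.+-monoʳ-< p 0<ε)

  *-monoˡ-≤ : ∀ {p q r} → 0ℚ ℚ.≤ r → p ℚ.≤ q → r ℚ.* p ℚ.≤ r ℚ.* q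
  *-monoˡ-≤ {r = r} 0≤r = ℚ.*-monoˡ-≤-nonNeg r {{ℚ.nonNegative 0≤r}}

  *-monoʳ-≤ : ∀ {p q r} → 0ℚ ℚ.≤ r → p ℚ.≤ q → p ℚ.* r ℚ.≤ q ℚ.* r
  *-monoʳ-≤ {r = r} 0≤r = ℚ.*-monoʳ-≤-nonNeg r {{ℚ.nonNegative 0≤r}}

  *-cancelˡ-< : ∀ {p q r} → 0ℚ ℚ.≤ r → r ℚ.* p ℚ.< r ℚ.* q → p ℚ.< q
  *-cancelˡ-< {r = r} 0≤r = ℚ.*-cancelˡ-<-nonNeg r {{ℚ.nonNegative 0≤r}}

signed : Sign → ℚ → ℚ
signed Sign.+ q = q
signed Sign.- q = ℚ.- q

opaque
  signed-* : ∀ s t p q → signed (s Sign.* t) (p ℚ.* q) ≡ signed s p ℚ.* signed t q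
  signed-* Sign.+ Sign.+ p q = refl
  signed-* Sign.+ Sign.- p q = ℚ.neg-distribʳ-* p q
  signed-* Sign.- Sign.+ p q = ℚ.neg-distribˡ-* p q
  signed-* Sign.- Sign.- p q = neg-*-neg p q

  signed-+ : ∀ s p q → signed s (p ℚ.+ q) ≡ signed s p ℚ.+ signed s q
  signed-+ Sign.+ p q = refl
  signed-+ Sign.- p q = ℚ.neg-distrib-+ p q

  ∣p∣≡signed : ∀ p → ∃[ s ] ∣ p ∣ ≡ signed s p
  ∣p∣≡signed p with ℚ.∣p∣≡p∨∣p∣≡-p p
  ... | inj₁ eq = Sign.+ , eq
  ... | inj₂ eq = Sign.- , eq

  p≤∣p∣ : ∀ p → p ℚ.≤ ∣ p ∣
  p≤∣p∣ p with ℚ.≤-total 0ℚ p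
  ... | inj₁ 0≤p = ℚ.≤-reflexive (sym (ℚ.0≤p⇒∣p∣≡p 0≤p))
  ... | inj₂ p≤0 = ℚ.≤-trans p≤0 (ℚ.0≤∣p∣ p)

  signed≤∣p∣ : ∀ s p → signed s p ℚ.≤ ∣ p ∣
  signed≤∣p∣ Sign.+ p = p≤∣p∣ p
  signed≤∣p∣ Sign.- p = subst (ℚ.- p ℚ.≤_) (ℚ.∣-p∣≡∣p∣ p) (p≤∣p∣ (ℚ.- p))

-- Records rather than synonyms, so that the real numbers involved can be
-- inferred from a proof.

infix 4 _≈_

record _≈_ (x y : ℝ) : Set where
  constructor mk≈
  field ≈⇒≃ : x ≃ y

open _≈_ public

record HasSign (s : Sign) (x : ℝ) : Set where
  constructor mkSign
  field
    {gap}    : ℚ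
    0<gap    : 0ℚ ℚ.< gap
    eventual : Eventually (λ n → gap ℚ.< signed s (seq x n))

opaque
  ≡⇒≈ : ∀ {x y} → (∀ n → seq x n ≡ seq y n) → x ≈ y
  ≡⇒≈ {x} {y} eq = mk≈ λ ε 0<ε → 0 , λ n _ →
    subst (λ r → ∣ r ∣ ℚ.< ε)
      (sym (trans (cong (ℚ._- seq y n) (eq n)) (ℚ.+-inverseʳ (seq y n)))) 0<ε

  ≈-refl : ∀ {x} → x ≈ x
  ≈-refl = ≡⇒≈ (λ _ → refl)

  ≈-sym : ∀ {x y} → x ≈ y → y ≈ x
  ≈-sym {x} {y} (mk≈ p) = mk≈ λ ε 0<ε → eventually-map
    (λ n → subst (ℚ._< ε) (trans (sym (ℚ.∣-p∣≡∣p∣ (seq x n ℚ.- seq y n)))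
                                 (cong ∣_∣ (sym (q-p≡-[p-q] (seq x n) (seq y n))))))
    (p ε 0<ε)

  ≈-trans : ∀ {x y z} → x ≈ y → y ≈ z → x ≈ z
  ≈-trans {x} {y} {z} (mk≈ p) (mk≈ q) = mk≈ λ ε 0<ε →
    eventually-zip (λ n → bound ε (seq x n) (seq y n) (seq z n))
      (p (ε ℚ.* ½) (0<ε*½ 0<ε)) (q (ε ℚ.* ½) (0<ε*½ 0<ε))
    where
    open ℚ.≤-Reasoning
    bound : ∀ ε a b c → ∣ a ℚ.- b ∣ ℚ.< ε ℚ.* ½ → ∣ b ℚ.- c ∣ ℚ.< ε ℚ.* ½ → ∣ a ℚ.- c ∣ ℚ.< ε
    bound ε a b c ab bc = begin-strict
      ∣ a ℚ.- c ∣                     ≡⟨ cong ∣_∣ (telescope a b c) ⟩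
      ∣ (a ℚ.- b) ℚ.+ (b ℚ.- c) ∣     ≤⟨ ℚ.∣p+q∣≤∣p∣+∣q∣ (a ℚ.- b) (b ℚ.- c) ⟩
      ∣ a ℚ.- b ∣ ℚ.+ ∣ b ℚ.- c ∣     <⟨ ℚ.+-mono-< ab bc ⟩
      ε ℚ.* ½ ℚ.+ ε ℚ.* ½             ≡⟨ ½+½ ε ⟩
      ε                               ∎

  +-cong : ∀ {x x′ y y′} → x ≈ x′ → y ≈ y′ → x + y ≈ x′ + y′
  +-cong {x} {x′} {y} {y′} (mk≈ p) (mk≈ q) = mk≈ λ ε 0<ε →
    eventually-zip (λ n → bound ε (seq x n) (seq x′ n) (seq y n) (seq y′ n))
      (p (ε ℚ.* ½) (0<ε*½ 0<ε)) (q (ε ℚ.* ½) (0<ε*½ 0<ε))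
    where
    open ℚ.≤-Reasoning
    bound : ∀ ε a a′ b b′ → ∣ a ℚ.- a′ ∣ ℚ.< ε ℚ.* ½ → ∣ b ℚ.- b′ ∣ ℚ.< ε ℚ.* ½ →
            ∣ (a ℚ.+ b) ℚ.- (a′ ℚ.+ b′) ∣ ℚ.< ε
    bound ε a a′ b b′ aa bb = begin-strict
      ∣ (a ℚ.+ b) ℚ.- (a′ ℚ.+ b′) ∣     ≡⟨ cong ∣_∣ (+-difference a b a′ b′) ⟩
      ∣ (a ℚ.- a′) ℚ.+ (b ℚ.- b′) ∣     ≤⟨ ℚ.∣p+q∣≤∣p∣+∣q∣ (a ℚ.- a′) (b ℚ.- b′) ⟩
      ∣ a ℚ.- a′ ∣ ℚ.+ ∣ b ℚ.- b′ ∣     <⟨ ℚ.+-mono-< aa bb ⟩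
      ε ℚ.* ½ ℚ.+ ε ℚ.* ½               ≡⟨ ½+½ ε ⟩
      ε                                 ∎

  *-cong : ∀ {x x′ y y′} → x ≈ x′ → y ≈ y′ → x * y ≈ x′ * y′
  *-cong {x} {x′} {y} {y′} (mk≈ p) (mk≈ q) = mk≈ λ ε 0<ε →
    let a , 0<a , x<a  = cauchy-bound (cauchy x)
        b , 0<b , y′<b = cauchy-bound (cauchy y′)
        δ , 0<δ , eq   = divide (a ℚ.+ b) (ℚ.+-mono-< 0<a 0<b) ε 0<ε
    in eventually-zip
         (λ n (u , v) (r , s) → subst (∣ seq x n ℚ.* seq y n ℚ.- seq x′ n ℚ.* seq y′ n ∣ ℚ.<_) eq
           (*-close {seq x n} {seq y n} {seq x′ n} {seq y′ n} u v r s))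
         (eventually-zip (λ _ → _,_) x<a y′<b)
         (eventually-zip (λ _ → _,_) (p δ 0<δ) (q δ 0<δ))

  sign-resp-≈ : ∀ {s x y} → x ≈ y → HasSign s x → HasSign s y
  sign-resp-≈ {s} {x} {y} (mk≈ p) (mkSign {ε} 0<ε h) = mkSign (0<ε*½ 0<ε)
    (eventually-zip (λ n → bound (seq x n) (seq y n)) h (p (ε ℚ.* ½) (0<ε*½ 0<ε)))
    where
    open ℚ.≤-Reasoning
    bound : ∀ a b → ε ℚ.< signed s a → ∣ a ℚ.- b ∣ ℚ.< ε ℚ.* ½ → ε ℚ.* ½ ℚ.< signed s b
    bound a b ε<a ab = +-cancelˡ-< (ε ℚ.* ½) (begin-strict
      ε ℚ.* ½ ℚ.+ ε ℚ.* ½                     ≡⟨ ½+½ ε ⟩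
      ε                                       <⟨ ε<a ⟩
      signed s a                              ≡⟨ cong (signed s) (add-subtract a b) ⟩
      signed s ((a ℚ.- b) ℚ.+ b)              ≡⟨ signed-+ s (a ℚ.- b) b ⟩
      signed s (a ℚ.- b) ℚ.+ signed s b       ≤⟨ ℚ.+-monoˡ-≤ (signed s b) (signed≤∣p∣ s (a ℚ.- b)) ⟩
      ∣ a ℚ.- b ∣ ℚ.+ signed s b              <⟨ ℚ.+-monoˡ-< (signed s b) ab ⟩
      ε ℚ.* ½ ℚ.+ signed s b                  ∎)

  sign-* : ∀ {s t x y} → HasSign s x → HasSign t y → HasSign (s Sign.* t) (x * y)
  sign-* {s} {t} {x} {y} (mkSign {ε} 0<ε h) (mkSign {δ} 0<δ k) = mkSign (pos*pos 0<ε 0<δ)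
    (eventually-zip (λ n ε<x δ<y → begin-strict
      ε ℚ.* δ                                   ≤⟨ *-monoˡ-≤ (ℚ.<⇒≤ 0<ε) (ℚ.<⇒≤ δ<y) ⟩
      ε ℚ.* signed t (seq y n)                  <⟨ ℚ.*-monoˡ-<-pos (signed t (seq y n)) {{ℚ.positive (ℚ.<-trans 0<δ δ<y)}} ε<x ⟩
      signed s (seq x n) ℚ.* signed t (seq y n) ≡⟨ signed-* s t (seq x n) (seq y n) ⟨
      signed (s Sign.* t) (seq x n ℚ.* seq y n) ∎) h k)
    where open ℚ.≤-Reasoning

  sign-unique : ∀ {s t x} → HasSign s x → HasSign t x → s ≡ t
  sign-unique {s} {t} {x} (mkSign {ε} 0<ε (M , h)) (mkSign {δ} 0<δ (N , k)) =
    compare s t (ℚ.<-trans 0<ε (h _ (ℕ.m≤m⊔n M N))) (ℚ.<-trans 0<δ (k _ (ℕ.m≤n⊔m M N)))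
    where
    compare : ∀ s t {q} → 0ℚ ℚ.< signed s q → 0ℚ ℚ.< signed t q → s ≡ t
    compare Sign.+ Sign.+ _ _ = refl
    compare Sign.- Sign.- _ _ = refl
    compare Sign.+ Sign.- {q} u v =
      ⊥-elim (ℚ.<-irrefl (sym (ℚ.+-inverseʳ q)) (ℚ.+-mono-< u v))
    compare Sign.- Sign.+ {q} u v =
      ⊥-elim (ℚ.<-irrefl (sym (ℚ.+-inverseˡ q)) (ℚ.+-mono-< u v))

  -- Eventually x is bounded away from 0 because y is bounded; from some
  -- index on it then varies too little to change sign.
  sign-factorˡ : ∀ {s x y} → HasSign s (x * y) → ∃[ t ] HasSign t x
  sign-factorˡ {s} {x} {y} (mkSign {ε} 0<ε (K , h)) =
    let b , 0<b , B , y<b = cauchy-bound (cauchy y)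
        δ , 0<δ , eq      = divide b 0<b ε 0<ε
        M , close         = cauchy x δ 0<δ
        N                 = M ℕ.⊔ (K ℕ.⊔ B)
        t , ∣x∣≡          = ∣p∣≡signed (seq x N)
        large : ∀ n → N ≤ n → δ ℚ.< ∣ seq x n ∣
        large n N≤n = big {seq x n} {seq y n} (ℚ.<⇒≤ 0<b) (subst (ℚ._< _) (sym eq) (h n (ℕ.≤-trans (ℕ.≤-trans (ℕ.m≤m⊔n K B) (ℕ.m≤n⊔m M (K ℕ.⊔ B))) N≤n)))
                          (y<b n (ℕ.≤-trans (ℕ.≤-trans (ℕ.m≤n⊔m K B) (ℕ.m≤n⊔m M (K ℕ.⊔ B))) N≤n))
    in t , mkSign 0<δ (N , λ n N≤n →
         steady t (large n N≤n) (subst (δ ℚ.<_) ∣x∣≡ (large N ℕ.≤-refl))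
           (close N n (ℕ.m≤m⊔n M (K ℕ.⊔ B)) (ℕ.≤-trans (ℕ.m≤m⊔n M (K ℕ.⊔ B)) N≤n)))
    where
    open ℚ.≤-Reasoning
    big : ∀ {p q b δ} → 0ℚ ℚ.≤ b → b ℚ.* δ ℚ.< signed s (p ℚ.* q) → ∣ q ∣ ℚ.< b → δ ℚ.< ∣ p ∣
    big {p} {q} {b} {δ} 0≤b lt q<b = *-cancelˡ-< 0≤b (begin-strict
      b ℚ.* δ              <⟨ lt ⟩
      signed s (p ℚ.* q)   ≤⟨ signed≤∣p∣ s (p ℚ.* q) ⟩
      ∣ p ℚ.* q ∣          ≡⟨ ℚ.∣p*q∣≡∣p∣*∣q∣ p q ⟩
      ∣ p ∣ ℚ.* ∣ q ∣      ≤⟨ *-monoˡ-≤ (ℚ.0≤∣p∣ p) (ℚ.<⇒≤ q<b) ⟩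
      ∣ p ∣ ℚ.* b          ≡⟨ ℚ.*-comm ∣ p ∣ b ⟩
      b ℚ.* ∣ p ∣          ∎)

    positive : ∀ t {p q δ} → δ ℚ.< signed t q → ∣ q ℚ.- p ∣ ℚ.< δ → 0ℚ ℚ.< signed t p
    positive t {p} {q} {δ} δ<q qp = +-cancelˡ-< δ (begin-strict
      δ ℚ.+ 0ℚ                              ≡⟨ ℚ.+-identityʳ δ ⟩
      δ                                     <⟨ δ<q ⟩
      signed t q                            ≡⟨ cong (signed t) (add-subtract q p) ⟩
      signed t ((q ℚ.- p) ℚ.+ p)            ≡⟨ signed-+ t (q ℚ.- p) p ⟩
      signed t (q ℚ.- p) ℚ.+ signed t p     ≤⟨ ℚ.+-monoˡ-≤ (signed t p) (signed≤∣p∣ t (q ℚ.- p)) ⟩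
      ∣ q ℚ.- p ∣ ℚ.+ signed t p            <⟨ ℚ.+-monoˡ-< (signed t p) qp ⟩
      δ ℚ.+ signed t p                      ∎)

    absolute : ∀ t {p} → 0ℚ ℚ.≤ signed t p → ∣ p ∣ ≡ signed t p
    absolute Sign.+ 0≤p = ℚ.0≤p⇒∣p∣≡p 0≤p
    absolute Sign.- {p} 0≤-p = trans (sym (ℚ.∣-p∣≡∣p∣ p)) (ℚ.0≤p⇒∣p∣≡p 0≤-p)

    steady : ∀ t {p q δ} → δ ℚ.< ∣ p ∣ → δ ℚ.< signed t q → ∣ q ℚ.- p ∣ ℚ.< δ → δ ℚ.< signed t p
    steady t {p} {q} δ<p δ<q qp =
      subst (_ ℚ.<_) (absolute t (ℚ.<⇒≤ (positive t {p} {q} δ<q qp))) δ<p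

  *-comm : ∀ x y → x * y ≈ y * x
  *-comm x y = ≡⇒≈ (λ n → ℚ.*-comm (seq x n) (seq y n))

  -- No sign of `y` is assumed: the product supplies one, and multiplicativity with uniqueness of
  -- signs identifies it, each sign being its own inverse.
  sign-cancelˡ : ∀ {s t x y} → HasSign s (x * y) → HasSign t x → HasSign (t Sign.* s) y
  sign-cancelˡ {s} {t} {x} {y} xy hx =
    let u , hy = sign-factorˡ {s} {y} {x} (sign-resp-≈ (*-comm x y) xy)
    in subst (λ v → HasSign v y) (determine (sign-unique (sign-* hx hy) xy)) hy
    where
    determine : ∀ {u} → t Sign.* u ≡ s → u ≡ t Sign.* s
    determine {u} eq = trans (trans (cong (Sign._* u) (sym (Sign.s*s≡+ t))) (Sign.*-assoc t t u))
                             (cong (t Sign.*_) eq)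

  -- Takes the place of the absence of zero divisors: once `x` is bounded away from 0, the absolute
  -- value of `y` is at most that of `x * y` divided by the bound.
  *-zero-cancelˡ : ∀ {s x y} → HasSign s x → x * y ≈ 0ℝ → y ≈ 0ℝ
  *-zero-cancelˡ {s} {x} {y} (mkSign {δ} 0<δ h) (mk≈ null) = mk≈ λ ε 0<ε →
    eventually-zip (λ n → bound (seq x n) (seq y n) ε) h (null (δ ℚ.* ε) (pos*pos 0<δ 0<ε))
    where
    open ℚ.≤-Reasoning
    bound : ∀ p q ε → δ ℚ.< signed s p → ∣ p ℚ.* q ℚ.- 0ℚ ∣ ℚ.< δ ℚ.* ε → ∣ q ℚ.- 0ℚ ∣ ℚ.< ε
    bound p q ε δ<p pq = *-cancelˡ-< {∣ q ℚ.- 0ℚ ∣} {ε} {δ} (ℚ.<⇒≤ 0<δ) (begin-strict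
      δ ℚ.* ∣ q ℚ.- 0ℚ ∣    ≡⟨ cong (λ r → δ ℚ.* ∣ r ∣) (p≡p-0 q) ⟨
      δ ℚ.* ∣ q ∣           ≤⟨ *-monoʳ-≤ (ℚ.0≤∣p∣ q) (ℚ.≤-trans (ℚ.<⇒≤ δ<p) (signed≤∣p∣ s p)) ⟩
      ∣ p ∣ ℚ.* ∣ q ∣       ≡⟨ ℚ.∣p*q∣≡∣p∣*∣q∣ p q ⟨
      ∣ p ℚ.* q ∣           ≡⟨ cong ∣_∣ (p≡p-0 (p ℚ.* q)) ⟩
      ∣ p ℚ.* q ℚ.- 0ℚ ∣    <⟨ pq ⟩
      δ ℚ.* ε               ∎)

  <⇒sign- : ∀ {x y} → x < y → HasSign Sign.- (x - y)
  <⇒sign- {x} {y} (ε , 0<ε , h) = mkSign 0<ε (eventually-map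
    (λ n lt → subst (ε ℚ.<_) (q-p≡-[p-q] (seq x n) (seq y n)) (p+ε<q⇒ε<q-p lt)) h)

  <⇒sign+ : ∀ {x y} → x < y → HasSign Sign.+ (y - x)
  <⇒sign+ (ε , 0<ε , h) = mkSign 0<ε (eventually-map (λ n → p+ε<q⇒ε<q-p) h)

  sign-⇒< : ∀ {x y} → HasSign Sign.- (x - y) → x < y
  sign-⇒< {x} {y} (mkSign {ε} 0<ε h) = ε , 0<ε , eventually-map
    (λ n lt → ε<q-p⇒p+ε<q (subst (ε ℚ.<_) (sym (q-p≡-[p-q] (seq x n) (seq y n))) lt)) h

  sign+⇒< : ∀ {x y} → HasSign Sign.+ (y - x) → x < y
  sign+⇒< (mkSign 0<ε h) = _ , 0<ε , eventually-map (λ n → ε<q-p⇒p+ε<q) h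

  <-trans : ∀ {x y z} → x < y → y < z → x < z
  <-trans {x} {y} {z} (ε , 0<ε , h) (δ , 0<δ , k) = ε , 0<ε , eventually-zip
    (λ n x+ε<y y+δ<z → ℚ.<-trans x+ε<y (ℚ.<-trans (p<p+ε 0<δ) y+δ<z)) h k

  <⇒eventually : ∀ {x y} → x < y → Eventually (λ n → seq x n ℚ.< seq y n)
  <⇒eventually (ε , 0<ε , h) = eventually-map (λ n → ℚ.<-trans (p<p+ε 0<ε)) h

  fromℚ-mono-< : ∀ {p q} → p ℚ.< q → fromℚ p < fromℚ q
  fromℚ-mono-< {p} {q} p<q =
    -- The gap has to satisfy p + gap < q strictly, so q - p itself is too large.
    let r , p<r , r<q = ℚ.<-dense p<q
    in r ℚ.- p
     , subst (ℚ._< r ℚ.- p) (ℚ.+-inverseʳ p) (ℚ.+-monoˡ-< (ℚ.- p) p<r)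
     , 0 , λ _ _ → subst (ℚ._< q) (sym (p+[q-p]≡q p r)) r<q

-- The three-term recurrence

module ℚ× = SemiringMult (CommutativeRing.semiring ℚ.+-*-commutativeRing)

ι : ℕ → ℚ
ι n = n ℚ×.× 1ℚ

opaque
  ι-+ : ∀ m n → ι (m ℕ.+ n) ≡ ι m ℚ.+ ι n
  ι-+ = ℚ×.×-homo-+ 1ℚ

  ι-* : ∀ m n → ι (m ℕ.* n) ≡ ι m ℚ.* ι n
  ι-* = ℚ×.×1-homo-*

  0≤ι : ∀ n → 0ℚ ℚ.≤ ι n
  0≤ι zero    = ℚ.≤-refl
  0≤ι (suc n) = ℚ.+-mono-≤ (ℚ.nonNegative⁻¹ 1ℚ) (0≤ι n)

  0<ι[1+n] : ∀ n → 0ℚ ℚ.< ι (suc n)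
  0<ι[1+n] n = ℚ.+-mono-<-≤ (ℚ.positive⁻¹ 1ℚ) (0≤ι n)

nC0≡1 : ∀ n → n C 0 ≡ 1
nC0≡1 n = trans (nCk≡nC[n∸k] {0} {n} z≤n) (nCn≡1 n)

-- Pascal's rule splits the binomial coefficient on the left into two that the induction covers, and
-- joins the results again.
absorption : ∀ n k → suc n ℕ.* (n C k) ≡ suc k ℕ.* (suc n C suc k)
absorption zero    zero    = refl
absorption zero    (suc k) =
  trans (cong (1 ℕ.*_) (k>n⇒nCk≡0 {0} {suc k} (s≤s z≤n)))
    (sym (trans (cong (suc (suc k) ℕ.*_) (k>n⇒nCk≡0 {1} {suc (suc k)} (s≤s (s≤s z≤n)))) (ℕ.*-zeroʳ (suc (suc k)))))
absorption (suc n) zero    =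
  trans (cong (suc (suc n) ℕ.*_) (nC0≡1 (suc n)))
    (trans (ℕ.*-identityʳ (suc (suc n)))
      (sym (trans (ℕ.*-identityˡ _) (nC1≡n (suc (suc n))))))
absorption (suc n) (suc k) = begin
  suc (suc n) ℕ.* Y                                      ≡⟨⟩
  Y ℕ.+ suc n ℕ.* Y                                      ≡⟨ cong (λ r → Y ℕ.+ suc n ℕ.* r) (nCk+nC[k+1]≡[n+1]C[k+1] n k) ⟨
  Y ℕ.+ suc n ℕ.* (n C k ℕ.+ n C suc k)                  ≡⟨ cong (Y ℕ.+_) (ℕ.*-distribˡ-+ (suc n) (n C k) (n C suc k)) ⟩
  Y ℕ.+ (suc n ℕ.* (n C k) ℕ.+ suc n ℕ.* (n C suc k))    ≡⟨ cong (Y ℕ.+_) (cong₂ ℕ._+_ (absorption n k) (absorption n (suc k))) ⟩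
  Y ℕ.+ (suc k ℕ.* Y ℕ.+ suc (suc k) ℕ.* Z)              ≡⟨ ℕ.+-assoc Y (suc k ℕ.* Y) (suc (suc k) ℕ.* Z) ⟨
  suc (suc k) ℕ.* Y ℕ.+ suc (suc k) ℕ.* Z                ≡⟨ ℕ.*-distribˡ-+ (suc (suc k)) Y Z ⟨
  suc (suc k) ℕ.* (Y ℕ.+ Z)                              ≡⟨ cong (suc (suc k) ℕ.*_) (nCk+nC[k+1]≡[n+1]C[k+1] (suc n) (suc k)) ⟩
  suc (suc k) ℕ.* (suc (suc n) C suc (suc k))            ∎
  where
  open ≡-Reasoning
  Y = suc n C suc k
  Z = suc n C suc (suc k)

coeff : ℕ → ℕ → ℕ → ℕ
coeff A B k = (A C k) ℕ.* (B C k)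

shift : (ℕ → ℕ) → ℕ → ℕ
shift c zero    = 0
shift c (suc k) = c k

-- The coefficient of tᵏ in the contiguous relation
--   (1 + A + B) J A B = B (1 − t) J A (B − 1) + (1 + A) J (A + 1) B
-- with B = 1 + b and the negative term moved to the left.
coeff-contiguous : ∀ A b k →
  (2 ℕ.+ A ℕ.+ b) ℕ.* coeff A (suc b) k ℕ.+ suc b ℕ.* shift (coeff A b) k ≡
  suc b ℕ.* coeff A b k ℕ.+ suc A ℕ.* coeff (suc A) (suc b) k
coeff-contiguous A b zero
  rewrite nC0≡1 A | nC0≡1 b | nC0≡1 (suc A) | nC0≡1 (suc b) =
  solve 2 (λ A b → (con 2 :+ A :+ b) :* con 1 :+ (con 1 :+ b) :* con 0
                   := (con 1 :+ b) :* con 1 :+ (con 1 :+ A) :* con 1) refl A b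
  where open ℕSolver.+-*-Solver
coeff-contiguous A b (suc j)
  rewrite sym (nCk+nC[k+1]≡[n+1]C[k+1] A j) | sym (nCk+nC[k+1]≡[n+1]C[k+1] b j) =
  trans (split A b X Y U V) (trans (cong (rest ℕ.+_) key) (sym (split′ A b X Y U V)))
  where
  open ≡-Reasoning
  X = A C j
  Y = A C suc j
  U = b C j
  V = b C suc j
  rest = (suc A ℕ.* Y) ℕ.* (U ℕ.+ V) ℕ.+ suc b ℕ.* (Y ℕ.* V)

  absorb : ∀ n → suc n ℕ.* (n C j) ≡ suc j ℕ.* (n C j ℕ.+ n C suc j)
  absorb n = trans (absorption n j) (cong (suc j ℕ.*_) (sym (nCk+nC[k+1]≡[n+1]C[k+1] n j)))

  -- Both sides are (1 + j) C(A+1, j+1) C(b+1, j+1): the factor 1 + j can be absorbed into either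
  -- binomial coefficient.
  key : (X ℕ.+ Y) ℕ.* (suc b ℕ.* U) ≡ (suc A ℕ.* X) ℕ.* (U ℕ.+ V)
  key = begin
    (X ℕ.+ Y) ℕ.* (suc b ℕ.* U)               ≡⟨ cong ((X ℕ.+ Y) ℕ.*_) (absorb b) ⟩
    (X ℕ.+ Y) ℕ.* (suc j ℕ.* (U ℕ.+ V))       ≡⟨ ℕ.*-assoc (X ℕ.+ Y) (suc j) (U ℕ.+ V) ⟨
    (X ℕ.+ Y) ℕ.* suc j ℕ.* (U ℕ.+ V)         ≡⟨ cong (ℕ._* (U ℕ.+ V)) (ℕ.*-comm (X ℕ.+ Y) (suc j)) ⟩
    suc j ℕ.* (X ℕ.+ Y) ℕ.* (U ℕ.+ V)         ≡⟨ cong (ℕ._* (U ℕ.+ V)) (absorb A) ⟨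
    suc A ℕ.* X ℕ.* (U ℕ.+ V)                 ∎

  open ℕSolver.+-*-Solver
  split : ∀ A b X Y U V →
    (2 ℕ.+ A ℕ.+ b) ℕ.* (Y ℕ.* (U ℕ.+ V)) ℕ.+ suc b ℕ.* (X ℕ.* U) ≡
    (suc A ℕ.* Y) ℕ.* (U ℕ.+ V) ℕ.+ suc b ℕ.* (Y ℕ.* V) ℕ.+ (X ℕ.+ Y) ℕ.* (suc b ℕ.* U)
  split = solve 6 (λ A b X Y U V →
    (con 2 :+ A :+ b) :* (Y :* (U :+ V)) :+ (con 1 :+ b) :* (X :* U) :=
    ((con 1 :+ A) :* Y) :* (U :+ V) :+ (con 1 :+ b) :* (Y :* V) :+ (X :+ Y) :* ((con 1 :+ b) :* U)) refl

  split′ : ∀ A b X Y U V →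
    suc b ℕ.* (Y ℕ.* V) ℕ.+ suc A ℕ.* ((X ℕ.+ Y) ℕ.* (U ℕ.+ V)) ≡
    (suc A ℕ.* Y) ℕ.* (U ℕ.+ V) ℕ.+ suc b ℕ.* (Y ℕ.* V) ℕ.+ (suc A ℕ.* X) ℕ.* (U ℕ.+ V)
  split′ = solve 6 (λ A b X Y U V →
    (con 1 :+ b) :* (Y :* V) :+ (con 1 :+ A) :* ((X :+ Y) :* (U :+ V)) :=
    ((con 1 :+ A) :* Y) :* (U :+ V) :+ (con 1 :+ b) :* (Y :* V) :+ ((con 1 :+ A) :* X) :* (U :+ V)) refl

-- Real operations act termwise on sequences, so polynomial identities over ℝ reduce to rational
-- arguments. In the nested form each degree step peels off one coefficient, which suits induction
-- better than a sum of powers.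
horner : (ℕ → ℕ) → ℕ → ℚ → ℚ
horner c zero    q = ι (c 0)
horner c (suc n) q = ι (c 0) ℚ.+ q ℚ.* horner (c ∘ suc) n q

module _ where
  open +-*-Solver

  opaque
    horner-+-step : ∀ a b q h k → (a ℚ.+ b) ℚ.+ q ℚ.* (h ℚ.+ k) ≡ (a ℚ.+ q ℚ.* h) ℚ.+ (b ℚ.+ q ℚ.* k)
    horner-+-step = solve 5 (λ a b q h k → (a :+ b) :+ q :* (h :+ k) := (a :+ q :* h) :+ (b :+ q :* k)) refl

    horner-*-step : ∀ m a q h → m ℚ.* a ℚ.+ q ℚ.* (m ℚ.* h) ≡ m ℚ.* (a ℚ.+ q ℚ.* h)
    horner-*-step = solve 4 (λ m a q h → m :* a :+ q :* (m :* h) := m :* (a :+ q :* h)) refl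

opaque
  horner-cong : ∀ {c d} → (∀ k → c k ≡ d k) → ∀ n q → horner c n q ≡ horner d n q
  horner-cong eq zero    q = cong ι (eq 0)
  horner-cong eq (suc n) q = cong₂ (λ a h → a ℚ.+ q ℚ.* h) (cong ι (eq 0)) (horner-cong (eq ∘ suc) n q)

  horner-+ : ∀ c d n q → horner (λ k → c k ℕ.+ d k) n q ≡ horner c n q ℚ.+ horner d n q
  horner-+ c d zero    q = ι-+ (c 0) (d 0)
  horner-+ c d (suc n) q =
    trans (cong₂ (λ a h → a ℚ.+ q ℚ.* h) (ι-+ (c 0) (d 0)) (horner-+ (c ∘ suc) (d ∘ suc) n q))
      (horner-+-step (ι (c 0)) (ι (d 0)) q _ _)

  horner-* : ∀ m c n q → horner (λ k → m ℕ.* c k) n q ≡ ι m ℚ.* horner c n q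
  horner-* m c zero    q = ι-* m (c 0)
  horner-* m c (suc n) q =
    trans (cong₂ (λ a h → a ℚ.+ q ℚ.* h) (ι-* m (c 0)) (horner-* m (c ∘ suc) n q))
      (horner-*-step (ι m) (ι (c 0)) q _)

  horner-zero : ∀ {c} → (∀ k → c k ≡ 0) → ∀ n q → horner c n q ≡ 0ℚ
  horner-zero eq zero    q = cong ι (eq 0)
  horner-zero eq (suc n) q =
    trans (cong₂ (λ a h → a ℚ.+ q ℚ.* h) (cong ι (eq 0)) (horner-zero (eq ∘ suc) n q))
      (trans (ℚ.+-identityˡ (q ℚ.* 0ℚ)) (ℚ.*-zeroʳ q))

  horner-truncate : ∀ {c m n} → n ≤ m → (∀ k → n ℕ.< k → c k ≡ 0) → ∀ q → horner c m q ≡ horner c n q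
  horner-truncate {m = zero}      z≤n vanish q = refl
  horner-truncate {c} {suc m}     z≤n vanish q =
    trans (cong (λ h → ι (c 0) ℚ.+ q ℚ.* h) (horner-zero (λ k → vanish (suc k) (s≤s z≤n)) m q))
      (trans (cong (ι (c 0) ℚ.+_) (ℚ.*-zeroʳ q)) (ℚ.+-identityʳ (ι (c 0))))
  horner-truncate {c} (s≤s n≤m)   vanish q =
    cong (λ h → ι (c 0) ℚ.+ q ℚ.* h) (horner-truncate n≤m (λ k n<k → vanish (suc k) (s≤s n<k)) q)

  horner-shift : ∀ c n q → horner (shift c) (suc n) q ≡ q ℚ.* horner c n q
  horner-shift c n q = ℚ.+-identityˡ (q ℚ.* horner c n q)

  horner-at-0 : ∀ c n → horner c n 0ℚ ≡ ι (c 0)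
  horner-at-0 c zero    = refl
  horner-at-0 c (suc n) =
    trans (cong (ι (c 0) ℚ.+_) (ℚ.*-zeroˡ (horner (c ∘ suc) n 0ℚ))) (ℚ.+-identityʳ (ι (c 0)))

J′ : ℕ → ℕ → ℚ → ℚ
J′ A B = horner (coeff A B) A

opaque
  coeff-vanishesˡ : ∀ A B k → A ℕ.< k → coeff A B k ≡ 0
  coeff-vanishesˡ A B k A<k = cong (ℕ._* (B C k)) (k>n⇒nCk≡0 A<k)

  horner-coeff : ∀ A B {n} → A ≤ n → ∀ q → horner (coeff A B) n q ≡ J′ A B q
  horner-coeff A B A≤n = horner-truncate A≤n (coeff-vanishesˡ A B)

  -- The two sums stop at different degrees, so both are first padded with zero coefficients up to
  -- degree `A + B`.
  J′-comm : ∀ A B q → J′ A B q ≡ J′ B A q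
  J′-comm A B q = begin
    J′ A B q                              ≡⟨ horner-coeff A B (ℕ.m≤m+n A B) q ⟨
    horner (coeff A B) (A ℕ.+ B) q        ≡⟨ horner-cong (λ k → ℕ.*-comm (A C k) (B C k)) (A ℕ.+ B) q ⟩
    horner (coeff B A) (A ℕ.+ B) q        ≡⟨ horner-coeff B A (ℕ.m≤n+m B A) q ⟩
    J′ B A q                              ∎
    where open ≡-Reasoning

  J′-contiguous : ∀ A b q →
    ι (2 ℕ.+ A ℕ.+ b) ℚ.* J′ A (suc b) q ℚ.+ ι (suc b) ℚ.* (q ℚ.* J′ A b q) ≡
    ι (suc b) ℚ.* J′ A b q ℚ.+ ι (suc A) ℚ.* J′ (suc A) (suc b) q
  J′-contiguous A b q = begin
    ι (2 ℕ.+ A ℕ.+ b) ℚ.* J′ A (suc b) q ℚ.+ ι (suc b) ℚ.* (q ℚ.* J′ A b q)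
      ≡⟨ cong₂ (λ u v → ι (2 ℕ.+ A ℕ.+ b) ℚ.* u ℚ.+ ι (suc b) ℚ.* v) (horner-coeff A (suc b) (ℕ.n≤1+n A) q) (horner-shift (coeff A b) A q) ⟨
    ι (2 ℕ.+ A ℕ.+ b) ℚ.* horner (coeff A (suc b)) (suc A) q ℚ.+ ι (suc b) ℚ.* horner (shift (coeff A b)) (suc A) q
      ≡⟨ combination (2 ℕ.+ A ℕ.+ b) (suc b) (coeff A (suc b)) (shift (coeff A b)) ⟨
    horner (λ k → (2 ℕ.+ A ℕ.+ b) ℕ.* coeff A (suc b) k ℕ.+ suc b ℕ.* shift (coeff A b) k) (suc A) q
      ≡⟨ horner-cong (coeff-contiguous A b) (suc A) q ⟩
    horner (λ k → suc b ℕ.* coeff A b k ℕ.+ suc A ℕ.* coeff (suc A) (suc b) k) (suc A) q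
      ≡⟨ combination (suc b) (suc A) (coeff A b) (coeff (suc A) (suc b)) ⟩
    ι (suc b) ℚ.* horner (coeff A b) (suc A) q ℚ.+ ι (suc A) ℚ.* J′ (suc A) (suc b) q
      ≡⟨ cong (λ u → ι (suc b) ℚ.* u ℚ.+ ι (suc A) ℚ.* J′ (suc A) (suc b) q) (horner-coeff A b (ℕ.n≤1+n A) q) ⟩
    ι (suc b) ℚ.* J′ A b q ℚ.+ ι (suc A) ℚ.* J′ (suc A) (suc b) q ∎
    where
    open ≡-Reasoning
    combination : ∀ m m′ c d → horner (λ k → m ℕ.* c k ℕ.+ m′ ℕ.* d k) (suc A) q ≡
                  ι m ℚ.* horner c (suc A) q ℚ.+ ι m′ ℚ.* horner d (suc A) q
    combination m m′ c d = trans (horner-+ (λ k → m ℕ.* c k) (λ k → m′ ℕ.* d k) (suc A) q)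
      (cong₂ ℚ._+_ (horner-* m c (suc A) q) (horner-* m′ d (suc A) q))

  -- X and Y stand for J (m + 2) (b + 1) and J (m + 1) b: the hypotheses,
  -- with weights a₂ s₂, s₂ s₄ and s₄ b₁ (1 − q), add up to a relation free
  -- of X and Y.
  eliminate : ∀ a₁ a₂ b₁ b₂ s₂ s₃ s₄ q J₋ J₀ J₊ X Y →
    s₄ ℚ.* X ℚ.+ a₂ ℚ.* (q ℚ.* J₀) ≡ a₂ ℚ.* J₀ ℚ.+ b₂ ℚ.* J₊ →
    s₃ ℚ.* J₀ ℚ.+ b₁ ℚ.* (q ℚ.* Y) ≡ b₁ ℚ.* Y ℚ.+ a₂ ℚ.* X →
    s₂ ℚ.* Y ℚ.+ a₁ ℚ.* (q ℚ.* J₋) ≡ a₁ ℚ.* J₋ ℚ.+ b₁ ℚ.* J₀ →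
    (a₂ ℚ.* b₂ ℚ.* s₂) ℚ.* J₊ ℚ.+ (a₁ ℚ.* b₁ ℚ.* s₄) ℚ.* ((1ℚ ℚ.- q) ℚ.* (1ℚ ℚ.- q)) ℚ.* J₋ ≡
    (s₂ ℚ.* s₃ ℚ.* s₄ ℚ.- (s₄ ℚ.* b₁ ℚ.* b₁ ℚ.+ a₂ ℚ.* a₂ ℚ.* s₂) ℚ.* (1ℚ ℚ.- q)) ℚ.* J₀
  eliminate a₁ a₂ b₁ b₂ s₂ s₃ s₄ q J₋ J₀ J₊ X Y e₁ e₂ e₃ =
    vanish (a₂ ℚ.* s₂) (s₂ ℚ.* s₄) (s₄ ℚ.* b₁ ℚ.* (1ℚ ℚ.- q))
      (identity a₁ a₂ b₁ b₂ s₂ s₃ s₄ q J₋ J₀ J₊ X Y)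
      (difference e₁) (difference e₂) (difference e₃)
    where
    difference : ∀ {l r} → l ≡ r → r ℚ.- l ≡ 0ℚ
    difference {l} refl = ℚ.+-inverseʳ l

    open +-*-Solver
    vanish : ∀ {x y d e f} u v w → x ≡ y ℚ.+ u ℚ.* d ℚ.+ (v ℚ.* e ℚ.+ w ℚ.* f) →
             d ≡ 0ℚ → e ≡ 0ℚ → f ≡ 0ℚ → x ≡ y
    vanish {y = y} u v w eq refl refl refl = trans eq
      (solve 4 (λ y u v w → y :+ u :* con 0ℚ :+ (v :* con 0ℚ :+ w :* con 0ℚ) := y) refl y u v w)

    identity : ∀ a₁ a₂ b₁ b₂ s₂ s₃ s₄ q J₋ J₀ J₊ X Y →
      (a₂ ℚ.* b₂ ℚ.* s₂) ℚ.* J₊ ℚ.+ (a₁ ℚ.* b₁ ℚ.* s₄) ℚ.* ((1ℚ ℚ.- q) ℚ.* (1ℚ ℚ.- q)) ℚ.* J₋ ≡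
      (s₂ ℚ.* s₃ ℚ.* s₄ ℚ.- (s₄ ℚ.* b₁ ℚ.* b₁ ℚ.+ a₂ ℚ.* a₂ ℚ.* s₂) ℚ.* (1ℚ ℚ.- q)) ℚ.* J₀
      ℚ.+ a₂ ℚ.* s₂ ℚ.* ((a₂ ℚ.* J₀ ℚ.+ b₂ ℚ.* J₊) ℚ.- (s₄ ℚ.* X ℚ.+ a₂ ℚ.* (q ℚ.* J₀)))
      ℚ.+ (s₂ ℚ.* s₄ ℚ.* ((b₁ ℚ.* Y ℚ.+ a₂ ℚ.* X) ℚ.- (s₃ ℚ.* J₀ ℚ.+ b₁ ℚ.* (q ℚ.* Y)))
           ℚ.+ s₄ ℚ.* b₁ ℚ.* (1ℚ ℚ.- q) ℚ.* ((a₁ ℚ.* J₋ ℚ.+ b₁ ℚ.* J₀) ℚ.- (s₂ ℚ.* Y ℚ.+ a₁ ℚ.* (q ℚ.* J₋))))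
    identity = solve 13 (λ a₁ a₂ b₁ b₂ s₂ s₃ s₄ q J₋ J₀ J₊ X Y →
      (a₂ :* b₂ :* s₂) :* J₊ :+ (a₁ :* b₁ :* s₄) :* ((con 1ℚ :- q) :* (con 1ℚ :- q)) :* J₋ :=
      (s₂ :* s₃ :* s₄ :- (s₄ :* b₁ :* b₁ :+ a₂ :* a₂ :* s₂) :* (con 1ℚ :- q)) :* J₀
      :+ a₂ :* s₂ :* ((a₂ :* J₀ :+ b₂ :* J₊) :- (s₄ :* X :+ a₂ :* (q :* J₀)))
      :+ (s₂ :* s₄ :* ((b₁ :* Y :+ a₂ :* X) :- (s₃ :* J₀ :+ b₁ :* (q :* Y)))
           :+ s₄ :* b₁ :* (con 1ℚ :- q) :* ((a₁ :* J₋ :+ b₁ :* J₀) :- (s₂ :* Y :+ a₁ :* (q :* J₋))))) refl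

  -- On the staircase (m, b), (m+1, b), (m+1, b+1), (m+2, b+1), (m+2, b+2) any three consecutive
  -- functions satisfy a contiguous relation. The three relations suffice to eliminate the two
  -- functions off the diagonal. The first and last triples use the relation with its parameters
  -- exchanged, which the symmetry of J permits.
  J′-three-term : ∀ m b →
    ∃[ k₊ ] ∃[ k₋ ] ∃[ l ] ∃[ l′ ] (0ℚ ℚ.< k₊ × 0ℚ ℚ.< k₋ × (∀ q →
      k₊ ℚ.* J′ (2 ℕ.+ m) (2 ℕ.+ b) q ℚ.+ k₋ ℚ.* ((1ℚ ℚ.- q) ℚ.* (1ℚ ℚ.- q)) ℚ.* J′ m b q ≡
      (l ℚ.- l′ ℚ.* (1ℚ ℚ.- q)) ℚ.* J′ (1 ℕ.+ m) (1 ℕ.+ b) q))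
  -- The inferred constants are k₊ = (m+2)(b+2)(m+b+2) and k₋ = (m+1)(b+1)(m+b+4).
  J′-three-term m b = _ , _
    , ι (2 ℕ.+ b ℕ.+ m) ℚ.* ι (2 ℕ.+ suc m ℕ.+ b) ℚ.* ι (2 ℕ.+ suc b ℕ.+ suc m)
    , ι (2 ℕ.+ suc b ℕ.+ suc m) ℚ.* ι (1 ℕ.+ b) ℚ.* ι (1 ℕ.+ b) ℚ.+ ι (2 ℕ.+ m) ℚ.* ι (2 ℕ.+ m) ℚ.* ι (2 ℕ.+ b ℕ.+ m)
    , pos*pos (pos*pos (0<ι[1+n] (suc m)) (0<ι[1+n] (suc b))) (0<ι[1+n] (suc (b ℕ.+ m)))
    , pos*pos (pos*pos (0<ι[1+n] m) (0<ι[1+n] b)) (0<ι[1+n] (2 ℕ.+ (b ℕ.+ suc m)))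
    , λ q → eliminate (ι (1 ℕ.+ m)) (ι (2 ℕ.+ m)) (ι (1 ℕ.+ b)) (ι (2 ℕ.+ b))
              (ι (2 ℕ.+ b ℕ.+ m)) (ι (2 ℕ.+ suc m ℕ.+ b)) (ι (2 ℕ.+ suc b ℕ.+ suc m)) q
              (J′ m b q) (J′ (suc m) (suc b) q) (J′ (2 ℕ.+ m) (2 ℕ.+ b) q)
              (J′ (2 ℕ.+ m) (suc b) q) (J′ (suc m) b q)
              (e₁ q) (J′-contiguous (suc m) b q) (e₃ q)
    where
    e₁ : ∀ q → ι (2 ℕ.+ suc b ℕ.+ suc m) ℚ.* J′ (2 ℕ.+ m) (suc b) q ℚ.+ ι (2 ℕ.+ m) ℚ.* (q ℚ.* J′ (suc m) (suc b) q) ≡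
               ι (2 ℕ.+ m) ℚ.* J′ (suc m) (suc b) q ℚ.+ ι (2 ℕ.+ b) ℚ.* J′ (2 ℕ.+ m) (2 ℕ.+ b) q
    e₁ q rewrite J′-comm (2 ℕ.+ m) (suc b) q | J′-comm (suc m) (suc b) q | J′-comm (2 ℕ.+ m) (2 ℕ.+ b) q =
      J′-contiguous (suc b) (suc m) q

    e₃ : ∀ q → ι (2 ℕ.+ b ℕ.+ m) ℚ.* J′ (suc m) b q ℚ.+ ι (1 ℕ.+ m) ℚ.* (q ℚ.* J′ m b q) ≡
               ι (1 ℕ.+ m) ℚ.* J′ m b q ℚ.+ ι (1 ℕ.+ b) ℚ.* J′ (suc m) (suc b) q
    e₃ q rewrite J′-comm (suc m) b q | J′-comm m b q | J′-comm (suc m) (suc b) q =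
      J′-contiguous b m q

-- Polynomials and interlacing

≈-setoid : Setoid 0ℓ 0ℓ
≈-setoid = record
  { Carrier       = ℝ
  ; _≈_           = _≈_
  ; isEquivalence = record { refl = ≈-refl ; sym = ≈-sym ; trans = ≈-trans }
  }

module ≈-Reasoning = SetoidReasoning ≈-setoid

hornerℝ : (ℕ → ℕ) → ℕ → ℝ → ℝ
hornerℝ c zero    t = fromℚ (ι (c 0))
hornerℝ c (suc n) t = fromℚ (ι (c 0)) + t * hornerℝ (c ∘ suc) n t

opaque
  seq-hornerℝ : ∀ c n t i → seq (hornerℝ c n t) i ≡ horner c n (seq t i)
  seq-hornerℝ c zero    t i = refl
  seq-hornerℝ c (suc n) t i = cong (λ h → ι (c 0) ℚ.+ seq t i ℚ.* h) (seq-hornerℝ (c ∘ suc) n t i)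

  hornerℝ-cong : ∀ c n {x y} → x ≈ y → hornerℝ c n x ≈ hornerℝ c n y
  hornerℝ-cong c zero    x≈y = ≈-refl
  hornerℝ-cong c (suc n) x≈y = +-cong ≈-refl (*-cong x≈y (hornerℝ-cong (c ∘ suc) n x≈y))

  seq-· : ∀ m x i → seq (m · x) i ≡ ι m ℚ.* seq x i
  seq-· zero    x i = sym (ℚ.*-zeroˡ (seq x i))
  seq-· (suc m) x i = trans (cong (seq x i ℚ.+_) (seq-· m x i))
    (solve 2 (λ r k → r :+ k :* r := (con 1ℚ :+ k) :* r) refl (seq x i) (ι m))
    where open +-*-Solver

  seq-sum-scale : ∀ {n} (f g : Vector ℝ n) r i → (∀ k → seq (f k) i ≡ r ℚ.* seq (g k) i) →
                  seq (sum f) i ≡ r ℚ.* seq (sum g) i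
  seq-sum-scale {zero}  f g r i eq = sym (ℚ.*-zeroʳ r)
  seq-sum-scale {suc n} f g r i eq =
    trans (cong₂ ℚ._+_ (eq zero) (seq-sum-scale (tail f) (tail g) r i (eq ∘ suc)))
      (sym (ℚ.*-distribˡ-+ r (seq (g zero) i) (seq (sum (tail g)) i)))

  seq-power-sum : ∀ (c : ℕ → ℕ) n t i →
    seq (sum {n = suc n} (λ k → c (toℕ k) · (t ^ toℕ k))) i ≡ horner c n (seq t i)
  seq-power-sum c zero    t i = trans (ℚ.+-identityʳ _) (trans (seq-· (c 0) 1ℝ i) (ℚ.*-identityʳ (ι (c 0))))
  seq-power-sum c (suc n) t i = cong₂ ℚ._+_
    (trans (seq-· (c 0) 1ℝ i) (ℚ.*-identityʳ (ι (c 0))))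
    (trans (seq-sum-scale {suc n} (λ k → c (suc (toℕ k)) · (t * t ^ toℕ k)) (λ k → c (suc (toℕ k)) · (t ^ toℕ k)) (seq t i) i (λ k → pull (toℕ k)))
      (cong (seq t i ℚ.*_) (seq-power-sum (c ∘ suc) n t i)))
    where
    pull : ∀ k → seq (c (suc k) · (t * t ^ k)) i ≡ seq t i ℚ.* seq (c (suc k) · (t ^ k)) i
    pull k = trans (seq-· (c (suc k)) (t * t ^ k) i)
      (trans (solve 3 (λ m p q → m :* (p :* q) := p :* (m :* q)) refl (ι (c (suc k))) (seq t i) (seq (t ^ k) i))
        (cong (seq t i ℚ.*_) (sym (seq-· (c (suc k)) (t ^ k) i))))
      where open +-*-Solver

  seq-J : ∀ A B t i → seq (J A B t) i ≡ J′ A B (seq t i)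
  seq-J A B = seq-power-sum (coeff A B) A

  J≈hornerℝ : ∀ A B t → J A B t ≈ hornerℝ (coeff A B) A t
  J≈hornerℝ A B t = ≡⇒≈ (λ i → trans (seq-J A B t i) (sym (seq-hornerℝ (coeff A B) A t i)))

-- Real coefficients are needed because division by t - a with a real `a` leaves the natural-number
-- coefficients of J behind. The coefficient `l` of the top power is an index of the predicate, so
-- that it is visibly unchanged by such divisions.
data IsPolynomial (l : ℝ) : ℕ → (ℝ → ℝ) → Set where
  constant : ∀ {p} → (∀ t → p t ≈ l) → IsPolynomial l 0 p
  extend   : ∀ {n p q} c → IsPolynomial l n q → (∀ t → p t ≈ c + t * q t) → IsPolynomial l (suc n) p

hornerℝ-isPolynomial : ∀ c n → IsPolynomial (fromℚ (ι (c n))) n (hornerℝ c n)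
hornerℝ-isPolynomial c zero    = constant (λ _ → ≈-refl)
hornerℝ-isPolynomial c (suc n) = extend (fromℚ (ι (c 0))) (hornerℝ-isPolynomial (c ∘ suc) n) (λ _ → ≈-refl)

product-of-differences : ∀ {n} → Vector ℝ n → ℝ → ℝ
product-of-differences ζ t = product (λ j → t - ζ j)

opaque
  -- Synthetic division: if `q t ≈ q a + (t - a) * r t` for the inner polynomial of `c + t * q t`,
  -- then the quotient is `q a + t * r t`.
  divide-linear : ∀ {n l p} → IsPolynomial l (suc n) p → ∀ a →
                  ∃[ q ] (IsPolynomial l n q × (∀ t → p t ≈ p a + (t - a) * q t))
  divide-linear {l = l} {p} (extend {q = q} c (constant q≈l) p≈) a = _ , constant (λ _ → ≈-refl) , λ t → begin
    p t                            ≈⟨ p≈ t ⟩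
    c + t * q t                    ≈⟨ +-cong ≈-refl (*-cong ≈-refl (q≈l t)) ⟩
    c + t * l                      ≈⟨ ≡⇒≈ (λ i → regroup (seq c i) (seq t i) (seq a i) (seq l i)) ⟩
    (c + a * l) + (t - a) * l      ≈⟨ +-cong (+-cong ≈-refl (*-cong ≈-refl (≈-sym (q≈l a)))) ≈-refl ⟩
    (c + a * q a) + (t - a) * l    ≈⟨ +-cong (≈-sym (p≈ a)) ≈-refl ⟩
    p a + (t - a) * l              ∎
    where
    open ≈-Reasoning
    open +-*-Solver
    regroup : ∀ c t a l → c ℚ.+ t ℚ.* l ≡ (c ℚ.+ a ℚ.* l) ℚ.+ (t ℚ.- a) ℚ.* l
    regroup = solve 4 (λ c t a l → c :+ t :* l := (c :+ a :* l) :+ (t :- a) :* l) refl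
  divide-linear {l = l} {p} (extend {q = q} c Q@(extend _ _ _) p≈) a with divide-linear Q a
  ... | r , R , q≈ = (λ t → q a + t * r t) , extend (q a) R (λ _ → ≈-refl) , λ t → begin
    p t                                          ≈⟨ p≈ t ⟩
    c + t * q t                                  ≈⟨ +-cong ≈-refl (*-cong ≈-refl (q≈ t)) ⟩
    c + t * (q a + (t - a) * r t)                ≈⟨ ≡⇒≈ (λ i → regroup (seq c i) (seq t i) (seq a i) (seq (q a) i) (seq (r t) i)) ⟩
    (c + a * q a) + (t - a) * (q a + t * r t)    ≈⟨ +-cong (≈-sym (p≈ a)) ≈-refl ⟩
    p a + (t - a) * (q a + t * r t)              ∎
    where
    open ≈-Reasoning
    open +-*-Solver
    regroup : ∀ c t a v w → c ℚ.+ t ℚ.* (v ℚ.+ (t ℚ.- a) ℚ.* w) ≡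
                            (c ℚ.+ a ℚ.* v) ℚ.+ (t ℚ.- a) ℚ.* (v ℚ.+ t ℚ.* w)
    regroup = solve 5 (λ c t a v w → c :+ t :* (v :+ (t :- a) :* w) :=
                                     (c :+ a :* v) :+ (t :- a) :* (v :+ t :* w)) refl

Increasing : ∀ {n} → Vector ℝ n → Set
Increasing ζ = ∀ i j → i Fin.< j → ζ i < ζ j

increasing-tail : ∀ {n} (ζ : Vector ℝ (suc n)) → Increasing ζ → Increasing (tail ζ)
increasing-tail ζ inc i j i<j = inc (suc i) (suc j) (s≤s i<j)

opaque
  ≤-<-increasing : ∀ {n} {x : Vector ℝ n} {i j y} → Increasing x → i Fin.≤ j → x j < y → x i < y
  ≤-<-increasing {x = x} {i} {j} {y} inc i≤j xj<y with ℕ.m≤n⇒m<n∨m≡n i≤j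
  ... | inj₁ i<j = <-trans {x i} {x j} {y} (inc i j i<j) xj<y
  ... | inj₂ eq  = subst (λ k → x k < y) (sym (Fin.toℕ-injective eq)) xj<y

  <-≤-increasing : ∀ {n} {x : Vector ℝ n} {i j y} → Increasing x → i Fin.≤ j → y < x i → y < x j
  <-≤-increasing {x = x} {i} {j} {y} inc i≤j y<xi with ℕ.m≤n⇒m<n∨m≡n i≤j
  ... | inj₁ i<j = <-trans {y} {x i} {x j} y<xi (inc i j i<j)
  ... | inj₂ eq  = subst (λ k → y < x k) (Fin.toℕ-injective eq) y<xi

  interlace⇒increasing : ∀ {n} {ζ : Vector ℝ n} {x : Vector ℝ (suc n)} →
                         Increasing x → StrictlyInterlace ζ x → Increasing ζ
  interlace⇒increasing {ζ = ζ} {x} inc inter i j i<j =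
    <-trans {ζ i} {x (inject₁ j)} {ζ j}
      (<-≤-increasing {x = x} {suc i} {inject₁ j} {ζ i} inc (subst (suc (toℕ i) ≤_) (sym (Fin.toℕ-inject₁ j)) i<j) (proj₂ (inter i)))
      (proj₁ (inter j))

  -- After division by t - ζ₀ the other zeros remain zeros of the quotient, because strict increase
  -- bounds each ζᵢ - ζ₀ away from 0 and lets it be cancelled.
  factor-theorem : ∀ {n l p} → IsPolynomial l n p → (ζ : Vector ℝ n) → Increasing ζ →
                   (∀ i → p (ζ i) ≈ 0ℝ) → ∀ t → p t ≈ l * product-of-differences ζ t
  factor-theorem {zero} {l} (constant p≈l) ζ inc root t =
    ≈-trans (p≈l t) (≡⇒≈ (λ i → sym (ℚ.*-identityʳ (seq l i))))
  factor-theorem {suc n} {l} {p} P ζ inc root t with divide-linear P (ζ zero)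
  ... | q , Q , p≈ = begin
    p t                                                            ≈⟨ factor t ⟩
    (t - ζ zero) * q t                                             ≈⟨ *-cong ≈-refl (factor-theorem Q (tail ζ) (increasing-tail ζ inc) root-q t) ⟩
    (t - ζ zero) * (l * product-of-differences (tail ζ) t)         ≈⟨ ≡⇒≈ (λ i → swap (seq (t - ζ zero) i) (seq l i) (seq (product-of-differences (tail ζ) t) i)) ⟩
    l * ((t - ζ zero) * product-of-differences (tail ζ) t)         ∎
    where
    open ≈-Reasoning

    factor : ∀ t → p t ≈ (t - ζ zero) * q t
    factor t = begin
      p t                                ≈⟨ p≈ t ⟩
      p (ζ zero) + (t - ζ zero) * q t    ≈⟨ +-cong (root zero) ≈-refl ⟩
      0ℝ + (t - ζ zero) * q t            ≈⟨ ≡⇒≈ (λ i → ℚ.+-identityˡ _) ⟩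
      (t - ζ zero) * q t                 ∎

    root-q : ∀ i → q (ζ (suc i)) ≈ 0ℝ
    root-q i = *-zero-cancelˡ {x = ζ (suc i) - ζ zero} {y = q (ζ (suc i))}
      (<⇒sign+ {ζ zero} {ζ (suc i)} (inc zero (suc i) (s≤s z≤n)))
      (≈-trans (≈-sym (factor (ζ (suc i)))) (root (suc i)))

    open +-*-Solver
    swap : ∀ d l r → d ℚ.* (l ℚ.* r) ≡ l ℚ.* (d ℚ.* r)
    swap = solve 3 (λ d l r → d :* (l :* r) := l :* (d :* r)) refl

  product-root : ∀ {n} (ζ : Vector ℝ n) j → product-of-differences ζ (ζ j) ≈ 0ℝ
  product-root ζ zero    = ≡⇒≈ (λ i → trans (cong (ℚ._* seq (product-of-differences (tail ζ) (ζ zero)) i)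
                                              (ℚ.+-inverseʳ (seq (ζ zero) i))) (ℚ.*-zeroˡ (seq (product-of-differences (tail ζ) (ζ zero)) i)))
  product-root ζ (suc j) = ≈-trans (*-cong {x = ζ (suc j) - ζ zero} ≈-refl (product-root (tail ζ) j))
                             (≡⇒≈ (λ i → ℚ.*-zeroʳ (seq (ζ (suc j) - ζ zero) i)))

-- Interlacing as a sign pattern

σ : ℕ → Sign
σ zero    = Sign.+
σ (suc n) = opposite (σ n)

-- The sign (-1)ⁿ⁻ʲ, σ n being (-1)ⁿ.
alternating : ∀ {n} → Fin (suc n) → Sign
alternating {n}     zero    = σ n
alternating {suc n} (suc j) = alternating j

alternating-inject₁ : ∀ {n} (j : Fin (suc n)) → alternating (inject₁ j) ≡ opposite (alternating j)
alternating-inject₁ {n}     zero    = refl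
alternating-inject₁ {suc n} (suc j) = alternating-inject₁ j

opaque
  sign-product-below : ∀ {n} (ζ : Vector ℝ n) {t} → (∀ i → t < ζ i) →
                       HasSign (σ n) (product-of-differences ζ t)
  sign-product-below {zero}  ζ below = mkSign (ℚ.positive⁻¹ ½) (0 , λ _ _ → ½<1)
    where
    ½<1 : ½ ℚ.< 1ℚ
    ½<1 = subst₂ ℚ._<_ (ℚ.*-identityˡ ½) (½+½ 1ℚ) (p<p+ε (0<ε*½ (ℚ.positive⁻¹ 1ℚ)))
  sign-product-below {suc n} ζ {t} below =
    sign-* {Sign.-} {σ n} {t - ζ zero} (<⇒sign- {t} {ζ zero} (below zero)) (sign-product-below (tail ζ) {t} (below ∘ suc))

  -- ζ₀ contributes a positive factor at x₁, x₂, ..., so removing x₀ and ζ₀ together leaves the same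
  -- situation with the same signs.
  interlace⇒signs : ∀ {n} (ζ : Vector ℝ n) (x : Vector ℝ (suc n)) → Increasing ζ → Increasing x →
                    StrictlyInterlace ζ x → ∀ j → HasSign (alternating j) (product-of-differences ζ (x j))
  interlace⇒signs ζ x inc-ζ inc-x inter zero = sign-product-below ζ {x zero} below
    where
    below : ∀ i → x zero < ζ i
    below i = ≤-<-increasing {x = x} {zero} {inject₁ i} {ζ i} inc-x z≤n (proj₁ (inter i))
  interlace⇒signs {suc n} ζ x inc-ζ inc-x inter (suc j) =
    sign-* {Sign.+} {alternating j} {x (suc j) - ζ zero}
      (<⇒sign+ {ζ zero} {x (suc j)} (<-≤-increasing {x = x} {suc zero} {suc j} {ζ zero} inc-x (s≤s z≤n) (proj₂ (inter zero))))
      (interlace⇒signs (tail ζ) (tail x) (increasing-tail ζ inc-ζ) (increasing-tail x inc-x) (inter ∘ suc) j)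

  -- Were ζ₀ above x₁, all factors at x₁ would be negative, giving
  -- the wrong sign; so ζ₀ can be split off at x₁, x₂, ….
  signs⇒interlace : ∀ {n} (ζ : Vector ℝ n) (x : Vector ℝ (suc n)) → Increasing ζ → Increasing x →
                    (∀ j → HasSign (alternating j) (product-of-differences ζ (x j))) → StrictlyInterlace ζ x
  signs⇒interlace {suc n} ζ x inc-ζ inc-x signs = λ { zero → x₀<ζ₀ , ζ₀<x₁ ; (suc j) → rest j }
    where
    ζ₀<x₁ : ζ zero < x (suc zero)
    ζ₀<x₁ with sign-factorˡ {alternating {suc n} (suc zero)} {x (suc zero) - ζ zero} (signs (suc zero))
    ... | Sign.+ , pos = sign+⇒< {ζ zero} {x (suc zero)} pos
    ... | Sign.- , neg = ⊥-elim (Sign.s≢opposite[s] (σ n)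
            (sign-unique (signs (suc zero)) (sign-product-below ζ {x (suc zero)}
              (λ i → <-≤-increasing {x = ζ} {zero} {i} {x (suc zero)} inc-ζ z≤n (sign-⇒< {x (suc zero)} {ζ zero} neg)))))

    rest : StrictlyInterlace (tail ζ) (tail x)
    rest = signs⇒interlace (tail ζ) (tail x) (increasing-tail ζ inc-ζ) (increasing-tail x inc-x) (λ j →
      sign-cancelˡ {alternating j} {Sign.+} {x (suc j) - ζ zero} (signs (suc j))
        (<⇒sign+ {ζ zero} {x (suc j)} (<-≤-increasing {x = x} {suc zero} {suc j} {ζ zero} inc-x (s≤s z≤n) ζ₀<x₁)))

    -- The later zeros are now known to lie above x₀, so they account for the sign `σ n`; the
    -- product has the opposite sign, hence x₀ - ζ₀ is negative.
    x₀<ζ₀ : x zero < ζ zero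
    x₀<ζ₀ = sign-⇒< {x zero} {ζ zero} (subst (λ s → HasSign s (x zero - ζ zero)) (Sign.s*opposite[s]≡- (σ n))
      (sign-cancelˡ {opposite (σ n)} {σ n} {product-of-differences (tail ζ) (x zero)} {x zero - ζ zero}
        (sign-resp-≈ (*-comm (x zero - ζ zero) (product-of-differences (tail ζ) (x zero))) (signs zero))
        (sign-product-below (tail ζ) {x zero} (λ i →
          ≤-<-increasing {x = x} {zero} {suc (inject₁ i)} {ζ (suc i)} inc-x z≤n (proj₁ (rest i))))))

-- Bisection

opaque
  toℚᵘ-ι : ∀ n → ℚ.toℚᵘ (ι n) ℚᵘ.≃ ℚᵘ.mkℚᵘ (ℤ.+ n) 0
  toℚᵘ-ι zero    = ℚᵘ.≃-refl
  toℚᵘ-ι (suc n) = ℚᵘ.≃-trans (ℚ.toℚᵘ-homo-+ 1ℚ (ι n))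
    (ℚᵘ.≃-trans (ℚᵘ.+-cong (ℚᵘ.≃-refl {ℚᵘ.1ℚᵘ}) (toℚᵘ-ι n))
      (ℚᵘ.*≡* (cong (λ m → (ℤ.1ℤ ℤ.+ m) ℤ.* ℤ.1ℤ) (ℤ.*-identityʳ (ℤ.+ n)))))

  archimedean : ∀ p → ∃[ n ] p ℚ.< ι n
  archimedean p@(ℚ.mkℚ i d-1 _) = suc ℤ.∣ i ∣ , ℚ.toℚᵘ-cancel-<
    (ℚᵘ.<-respʳ-≃ (ℚᵘ.≃-sym (toℚᵘ-ι (suc ℤ.∣ i ∣))) (ℚᵘ.*<* (begin-strict
      i ℤ.* ℤ.1ℤ                                   ≡⟨ ℤ.*-identityʳ i ⟩
      i                                            ≤⟨ i≤∣i∣ i ⟩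
      ℤ.+ ℤ.∣ i ∣                                  <⟨ ℤ.+<+ (ℕ.n<1+n ℤ.∣ i ∣) ⟩
      ℤ.+ suc ℤ.∣ i ∣                              ≤⟨ ℤ.+≤+ (ℕ.m≤m*n (suc ℤ.∣ i ∣) (suc d-1)) ⟩
      ℤ.+ (suc ℤ.∣ i ∣ ℕ.* suc d-1)                ≡⟨ ℤ.pos-* (suc ℤ.∣ i ∣) (suc d-1) ⟩
      ℤ.+ suc ℤ.∣ i ∣ ℤ.* ℤ.+ suc d-1              ∎)))
    where
    open ℤ.≤-Reasoning
    i≤∣i∣ : ∀ i → i ℤ.≤ ℤ.+ ℤ.∣ i ∣
    i≤∣i∣ (ℤ.+ n)    = ℤ.≤-refl
    i≤∣i∣ ℤ.-[1+ n ] = ℤ.-≤+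

  0≤q-p⇒p≤q : ∀ {p q} → 0ℚ ℚ.≤ q ℚ.- p → p ℚ.≤ q
  0≤q-p⇒p≤q {p} {q} le = subst₂ ℚ._≤_ (ℚ.+-identityʳ p) (p+[q-p]≡q p q) (ℚ.+-monoʳ-≤ p le)

  p≤q⇒0≤q-p : ∀ {p q} → p ℚ.≤ q → 0ℚ ℚ.≤ q ℚ.- p
  p≤q⇒0≤q-p {p} {q} le = subst (ℚ._≤ q ℚ.- p) (ℚ.+-inverseʳ p) (ℚ.+-monoˡ-≤ (ℚ.- p) le)

  ∣p-q∣≤width : ∀ {l r p q} → l ℚ.≤ p → p ℚ.≤ r → l ℚ.≤ q → q ℚ.≤ r → ∣ p ℚ.- q ∣ ℚ.≤ r ℚ.- l
  ∣p-q∣≤width {l} {r} {p} {q} l≤p p≤r l≤q q≤r with ℚ.∣p∣≡p∨∣p∣≡-p (p ℚ.- q)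
  ... | inj₁ eq = subst (ℚ._≤ r ℚ.- l) (sym eq) (ℚ.+-mono-≤ p≤r (ℚ.neg-antimono-≤ l≤q))
  ... | inj₂ eq = subst (ℚ._≤ r ℚ.- l) (sym (trans eq (sym (q-p≡-[p-q] p q))))
                    (ℚ.+-mono-≤ q≤r (ℚ.neg-antimono-≤ l≤p))

module _ where
  open +-*-Solver

  opaque
    midpoint-left : ∀ l r → (l ℚ.+ r) ℚ.* ½ ℚ.- l ≡ (r ℚ.- l) ℚ.* ½
    midpoint-left = solve 2 (λ l r → (l :+ r) :* con ½ :- l := (r :- l) :* con ½) refl

    midpoint-right : ∀ l r → r ℚ.- (l ℚ.+ r) ℚ.* ½ ≡ (r ℚ.- l) ℚ.* ½
    midpoint-right = solve 2 (λ l r → r :- (l :+ r) :* con ½ := (r :- l) :* con ½) refl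

record Bracket (P Q : ℚ → Set) : Set where
  constructor bracket
  field
    lower upper : ℚ
    lower≤upper : lower ℚ.≤ upper
    at-lower    : P lower
    at-upper    : Q upper

open Bracket

-- `P` and `Q` may overlap, so weak inequalities decided by `≤-total` will do. Both end sequences
-- are kept as real numbers: `P` holds all along the left one and `Q` all along the right one.
module Bisection {P Q : ℚ → Set} (decide : ∀ p → P p ⊎ Q p) (initial : Bracket P Q) where

  opaque
    0≤half : ∀ {d} → 0ℚ ℚ.≤ d → 0ℚ ℚ.≤ d ℚ.* ½
    0≤half {d} 0≤d = subst (ℚ._≤ d ℚ.* ½) (ℚ.*-zeroˡ ½) (*-monoʳ-≤ (ℚ.nonNegative⁻¹ ½) 0≤d)

    l≤midpoint : ∀ {l r} → l ℚ.≤ r → l ℚ.≤ (l ℚ.+ r) ℚ.* ½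
    l≤midpoint {l} {r} l≤r = 0≤q-p⇒p≤q (subst (0ℚ ℚ.≤_) (sym (midpoint-left l r)) (0≤half (p≤q⇒0≤q-p l≤r)))

    midpoint≤r : ∀ {l r} → l ℚ.≤ r → (l ℚ.+ r) ℚ.* ½ ℚ.≤ r
    midpoint≤r {l} {r} l≤r = 0≤q-p⇒p≤q (subst (0ℚ ℚ.≤_) (sym (midpoint-right l r)) (0≤half (p≤q⇒0≤q-p l≤r)))

  width : Bracket P Q → ℚ
  width b = upper b ℚ.- lower b

  record Halved (b : Bracket P Q) : Set where
    field
      half         : Bracket P Q
      lower-grows  : lower b ℚ.≤ lower half
      upper-drops  : upper half ℚ.≤ upper b
      width-halves : width half ≡ width b ℚ.* ½

  open Halved

  opaque
    halve : ∀ b → Halved b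
    halve (bracket l r l≤r p q) with decide ((l ℚ.+ r) ℚ.* ½)
    ... | inj₁ p′ = record
      { half = bracket ((l ℚ.+ r) ℚ.* ½) r (midpoint≤r l≤r) p′ q
      ; lower-grows = l≤midpoint l≤r ; upper-drops = ℚ.≤-refl ; width-halves = midpoint-right l r }
    ... | inj₂ q′ = record
      { half = bracket l ((l ℚ.+ r) ℚ.* ½) (l≤midpoint l≤r) p q′
      ; lower-grows = ℚ.≤-refl ; upper-drops = midpoint≤r l≤r ; width-halves = midpoint-left l r }

  iterate : ℕ → Bracket P Q
  iterate zero    = initial
  iterate (suc n) = half (halve (iterate n))

  l r : ℕ → ℚ
  l n = lower (iterate n)
  r n = upper (iterate n)

  opaque
    nested : ∀ m k → l m ℚ.≤ l (k ℕ.+ m) × r (k ℕ.+ m) ℚ.≤ r m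
    nested m zero    = ℚ.≤-refl , ℚ.≤-refl
    nested m (suc k) =
      let l≤ , ≤r = nested m k
      in ℚ.≤-trans l≤ (lower-grows (halve (iterate (k ℕ.+ m)))) , ℚ.≤-trans (upper-drops (halve (iterate (k ℕ.+ m)))) ≤r

    nested-≤ : ∀ {m n} → m ≤ n → l m ℚ.≤ l n × r n ℚ.≤ r m
    nested-≤ {m} {n} m≤n = subst (λ k → l m ℚ.≤ l k × r k ℚ.≤ r m) (ℕ.m∸n+n≡m m≤n) (nested m (n ℕ.∸ m))

    -- The width decays like a power of ½, but the bound 1/(n+1), from `2 + n ≤ 2 (1 + n)`, is
    -- enough for the archimedean property to finish.
    width-bound : ∀ n → ι (suc n) ℚ.* width (iterate n) ℚ.≤ width initial
    width-bound zero    = ℚ.≤-reflexive (trans (cong (ℚ._* width initial) (ℚ.+-identityʳ 1ℚ)) (ℚ.*-identityˡ (width initial)))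
    width-bound (suc n) = begin
      ι (2 ℕ.+ n) ℚ.* width (iterate (suc n))       ≡⟨ cong (ι (2 ℕ.+ n) ℚ.*_) (width-halves (halve (iterate n))) ⟩
      ι (2 ℕ.+ n) ℚ.* (width (iterate n) ℚ.* ½)     ≤⟨ *-monoʳ-≤ (0≤half (p≤q⇒0≤q-p (lower≤upper (iterate n)))) 2+n≤ ⟩
      (ι (suc n) ℚ.+ ι (suc n)) ℚ.* (width (iterate n) ℚ.* ½)
                                                    ≡⟨ cancel (ι (suc n)) (width (iterate n)) ⟩
      ι (suc n) ℚ.* width (iterate n)               ≤⟨ width-bound n ⟩
      width initial                                   ∎
      where
      open ℚ.≤-Reasoning
      2+n≤ : ι (2 ℕ.+ n) ℚ.≤ ι (suc n) ℚ.+ ι (suc n)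
      2+n≤ = ℚ.+-monoˡ-≤ (ι (suc n)) (subst (ℚ._≤ ι (suc n)) (ℚ.+-identityʳ 1ℚ) (ℚ.+-monoʳ-≤ 1ℚ (0≤ι n)))

      open +-*-Solver
      cancel : ∀ i w → (i ℚ.+ i) ℚ.* (w ℚ.* ½) ≡ i ℚ.* w
      cancel = solve 2 (λ i w → (i :+ i) :* (w :* con ½) := i :* w) refl

    narrow : ∀ ε → 0ℚ ℚ.< ε → ∃[ N ] r N ℚ.- l N ℚ.< ε
    narrow ε 0<ε =
      -- The added 1 keeps the dividend positive when the initial width is 0, and makes the final
      -- comparison strict.
      let δ , _ , eq = divide ε 0<ε (1ℚ ℚ.+ width initial) (ℚ.+-mono-<-≤ (ℚ.positive⁻¹ 1ℚ) (p≤q⇒0≤q-p (lower≤upper initial)))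
          N , δ<N    = archimedean δ
      in N , *-cancelˡ-< {r = ι (suc N)} (0≤ι (suc N)) (begin-strict
        ι (suc N) ℚ.* (r N ℚ.- l N)    ≤⟨ width-bound N ⟩
        width initial                    ≡⟨ ℚ.+-identityˡ (width initial) ⟨
        0ℚ ℚ.+ width initial             <⟨ ℚ.+-monoˡ-< (width initial) (ℚ.positive⁻¹ 1ℚ) ⟩
        1ℚ ℚ.+ width initial             ≡⟨ eq ⟨
        ε ℚ.* δ                        ≤⟨ *-monoˡ-≤ (ℚ.<⇒≤ 0<ε) (ℚ.<⇒≤ δ<N) ⟩
        ε ℚ.* ι N                      ≡⟨ ℚ.*-comm ε (ι N) ⟩
        ι N ℚ.* ε                      ≡⟨ ℚ.+-identityˡ (ι N ℚ.* ε) ⟨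
        0ℚ ℚ.+ ι N ℚ.* ε               ≤⟨ ℚ.+-monoˡ-≤ (ι N ℚ.* ε) (subst (0ℚ ℚ.≤_) (sym (ℚ.*-identityˡ ε)) (ℚ.<⇒≤ 0<ε)) ⟩
        1ℚ ℚ.* ε ℚ.+ ι N ℚ.* ε         ≡⟨ ℚ.*-distribʳ-+ ε 1ℚ (ι N) ⟨
        ι (suc N) ℚ.* ε                ∎)
      where open ℚ.≤-Reasoning

    l≤r : ∀ {m n} → m ≤ n → l m ℚ.≤ r n × l n ℚ.≤ r m
    l≤r {m} {n} m≤n = ℚ.≤-trans (proj₁ (nested-≤ m≤n)) (lower≤upper (iterate n))
                    , ℚ.≤-trans (lower≤upper (iterate n)) (proj₂ (nested-≤ m≤n))

    l-cauchy : IsCauchy l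
    l-cauchy ε 0<ε =
      let N , w<ε = narrow ε 0<ε
      in N , λ m n N≤m N≤n → ℚ.≤-<-trans
           (∣p-q∣≤width (proj₁ (nested-≤ N≤m)) (proj₂ (l≤r N≤m)) (proj₁ (nested-≤ N≤n)) (proj₂ (l≤r N≤n))) w<ε

    r-cauchy : IsCauchy r
    r-cauchy ε 0<ε =
      let N , w<ε = narrow ε 0<ε
      in N , λ m n N≤m N≤n → ℚ.≤-<-trans
           (∣p-q∣≤width (proj₁ (l≤r N≤m)) (proj₂ (nested-≤ N≤m)) (proj₁ (l≤r N≤n)) (proj₂ (nested-≤ N≤n))) w<ε

  limitˡ limitʳ : ℝ
  limitˡ = mkℝ l l-cauchy
  limitʳ = mkℝ r r-cauchy

  opaque
    limits-agree : limitˡ ≈ limitʳ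
    limits-agree = mk≈ λ ε 0<ε →
      let N , w<ε = narrow ε 0<ε
      in N , λ n N≤n → ℚ.≤-<-trans
           (∣p-q∣≤width (proj₁ (nested-≤ N≤n)) (proj₂ (l≤r N≤n)) (proj₁ (l≤r N≤n)) (proj₂ (nested-≤ N≤n))) w<ε

-- Intermediate values of polynomials

opaque
  fromℚ-sign : ∀ {s x} p → 0ℚ ℚ.< signed s p → (∀ i → seq x i ≡ p) → HasSign s x
  fromℚ-sign {s} p 0<p eq =
    let ε , 0<ε , ε<p = ℚ.<-dense 0<p
    in mkSign 0<ε (0 , λ n _ → subst (λ q → ε ℚ.< signed s q) (sym (eq n)) ε<p)

  sign-neg : ∀ {s x} → HasSign s x → HasSign (opposite s) (- x)
  sign-neg {s} {x} (mkSign {ε} 0<ε h) = mkSign 0<ε (eventually-map (λ n → subst (ε ℚ.<_) (flip s (seq x n))) h)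
    where
    flip : ∀ s p → signed s p ≡ signed (opposite s) (ℚ.- p)
    flip Sign.+ p = sym (neg-involutive p)
    flip Sign.- p = refl

  sum-zero⇒opposite-sign : ∀ {s x y} → x + y ≈ 0ℝ → HasSign s y → HasSign (opposite s) x
  sum-zero⇒opposite-sign {s} {x} {y} x+y≈0 hy = sign-resp-≈ -y≈x (sign-neg hy)
    where
    open +-*-Solver
    -y≈x : - y ≈ x
    -y≈x = ≈-trans (≡⇒≈ (λ i → sym (ℚ.+-identityˡ (seq (- y) i))))
      (≈-trans (+-cong {x′ = x + y} {y = - y} (≈-sym x+y≈0) ≈-refl)
        (≡⇒≈ (λ i → solve 2 (λ x y → (x :+ y) :- y := x) refl (seq x i) (seq y i))))

  -- Upgrades a weak inequality, all that a limit preserves, to a strict one: a number bounded away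
  -- from 0 has some sign, and the inequality excludes the wrong one.
  weak-sign : ∀ t {u x} → (∀ i → 0ℚ ℚ.≤ signed t (seq x i)) → HasSign u x → HasSign t x
  weak-sign t {u} {x} 0≤x hx@(mkSign 0<ε (N , h)) =
    subst (λ v → HasSign v x) (agree t u (0≤x N) (ℚ.<-trans 0<ε (h N ℕ.≤-refl))) hx
    where
    agree : ∀ t u {p} → 0ℚ ℚ.≤ signed t p → 0ℚ ℚ.< signed u p → u ≡ t
    agree Sign.+ Sign.+ _ _ = refl
    agree Sign.- Sign.- _ _ = refl
    agree Sign.+ Sign.- {p} v w = ⊥-elim (ℚ.<-irrefl (sym (ℚ.+-inverseʳ p)) (ℚ.+-mono-≤-< v w))
    agree Sign.- Sign.+ {p} v w = ⊥-elim (ℚ.<-irrefl (sym (ℚ.+-inverseˡ p)) (ℚ.+-mono-≤-< v w))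

  -- The values at matching left and right ends have weakly opposite signs, so the one on the left
  -- is no larger than their difference. The difference is null since both end sequences represent
  -- one real number and polynomials respect `≈`.
  intermediate-value : ∀ c n s {a b} → a ℚ.< b →
    0ℚ ℚ.< signed (opposite s) (horner c (suc n) a) → 0ℚ ℚ.< signed s (horner c (suc n) b) →
    ∃[ x ] (fromℚ a < x × x < fromℚ b × hornerℝ c (suc n) x ≈ 0ℝ)
  intermediate-value c n s {a} {b} a<b fa fb = ξ , a<ξ , ξ<b , root
    where
    nonpositive : ∀ s {p} → 0ℚ ℚ.< signed (opposite s) p → signed s p ℚ.≤ 0ℚ
    nonpositive Sign.+ {p} 0<-p = 0≤q-p⇒p≤q (subst (0ℚ ℚ.≤_) (sym (ℚ.+-identityˡ (ℚ.- p))) (ℚ.<⇒≤ 0<-p))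
    nonpositive Sign.- {p} 0<p  = ℚ.neg-antimono-≤ (ℚ.<⇒≤ 0<p)

    open Bisection (λ p → ℚ.≤-total (signed s (horner c (suc n) p)) 0ℚ)
      (bracket a b (ℚ.<⇒≤ a<b) (nonpositive s fa) (ℚ.<⇒≤ fb))

    ξ : ℝ
    ξ = limitˡ

    small : ∀ s {p q} → signed s p ℚ.≤ 0ℚ → 0ℚ ℚ.≤ signed s q → ∣ p ℚ.- 0ℚ ∣ ℚ.≤ ∣ p ℚ.- q ∣
    small Sign.+ {p} {q} p≤0 0≤q = ℚ.≤-trans
      (∣p-q∣≤width ℚ.≤-refl (ℚ.≤-trans p≤0 0≤q) p≤0 0≤q)
      (subst (ℚ._≤ ∣ p ℚ.- q ∣) (sym (q-p≡-[p-q] p q)) (signed≤∣p∣ Sign.- (p ℚ.- q)))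
    small Sign.- {p} {q} -p≤0 0≤-q = ℚ.≤-trans
      (∣p-q∣≤width (ℚ.≤-trans q≤0 0≤p) ℚ.≤-refl q≤0 0≤p) (p≤∣p∣ (p ℚ.- q))
      where
      0≤p : 0ℚ ℚ.≤ p
      0≤p = subst (0ℚ ℚ.≤_) (neg-involutive p) (ℚ.neg-antimono-≤ -p≤0)
      q≤0 : q ℚ.≤ 0ℚ
      q≤0 = 0≤q-p⇒p≤q (subst (0ℚ ℚ.≤_) (sym (ℚ.+-identityˡ (ℚ.- q))) 0≤-q)

    root : hornerℝ c (suc n) ξ ≈ 0ℝ
    root = mk≈ λ ε 0<ε → eventually-map (λ i → ℚ.≤-<-trans
      (small s (subst (λ p → signed s p ℚ.≤ 0ℚ) (sym (seq-hornerℝ c (suc n) limitˡ i)) (at-lower (iterate i)))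
               (subst (λ p → 0ℚ ℚ.≤ signed s p) (sym (seq-hornerℝ c (suc n) limitʳ i)) (at-upper (iterate i)))))
      (≈⇒≃ (hornerℝ-cong c (suc n) limits-agree) ε 0<ε)

    -- Bisection yields only weak inequalities between `ξ` and the ends. Dividing by t - e gives
    -- `0 ≈ f e + (ξ - e) * q ξ`, where f is the polynomial; as f e is nonzero, the product and with
    -- it `ξ - e` is bounded away from 0.
    endpoint-sign : ∀ t e → 0ℚ ℚ.< signed t (horner c (suc n) e) → ∃[ u ] HasSign u (ξ - fromℚ e)
    endpoint-sign t e 0<fe =
      let q , _ , p≈ = divide-linear (hornerℝ-isPolynomial c (suc n)) (fromℚ e)
          fe         = hornerℝ c (suc n) (fromℚ e)
          sum-zero   = ≈-trans (≡⇒≈ {x = (ξ - fromℚ e) * q ξ + fe} {y = fe + (ξ - fromℚ e) * q ξ}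
                                 (λ i → ℚ.+-comm (seq ((ξ - fromℚ e) * q ξ) i) (seq fe i)))
                         (≈-trans (≈-sym (p≈ ξ)) root)
      in sign-factorˡ {opposite t} {ξ - fromℚ e} {q ξ}
           (sum-zero⇒opposite-sign sum-zero (fromℚ-sign {t} {fe} (horner c (suc n) e) 0<fe (seq-hornerℝ c (suc n) (fromℚ e))))

    a<ξ : fromℚ a < ξ
    a<ξ = sign+⇒< {fromℚ a} {ξ}
      (weak-sign Sign.+ (λ i → p≤q⇒0≤q-p (proj₁ (nested-≤ {0} {i} z≤n))) (proj₂ (endpoint-sign (opposite s) a fa)))

    ξ<b : ξ < fromℚ b
    ξ<b = sign-⇒< {ξ} {fromℚ b}
      (weak-sign Sign.- (λ i → subst (0ℚ ℚ.≤_) (q-p≡-[p-q] (l i) b) (p≤q⇒0≤q-p (proj₂ (l≤r {0} {i} z≤n)))) (proj₂ (endpoint-sign s b fb)))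

-- Zeros of J

1≤nCk : ∀ {n k} → k ≤ n → 1 ≤ n C k
1≤nCk {n} {zero}  k≤n = ℕ.≤-reflexive (sym (nC0≡1 n))
1≤nCk {suc n} {suc k} (s≤s k≤n) =
  subst (1 ≤_) (nCk+nC[k+1]≡[n+1]C[k+1] n k) (ℕ.≤-trans (1≤nCk k≤n) (ℕ.m≤m+n (n C k) (n C suc k)))

opaque
  1≤ι : ∀ {n} → 1 ≤ n → 1ℚ ℚ.≤ ι n
  1≤ι {suc n} (s≤s _) = subst (ℚ._≤ ι (suc n)) (ℚ.+-identityʳ 1ℚ) (ℚ.+-monoʳ-≤ 1ℚ (0≤ι n))

  -- The bound 1 instead of 0 makes the induction work: if the inner value is at least 1 in size and
  -- -q is at least 1 + c₀, their product outweighs the constant c₀ by 1.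
  sign-near-−∞ : ∀ c n → 1 ≤ c n → ∃[ M ] (∀ q → q ℚ.≤ M → 1ℚ ℚ.≤ signed (σ n) (horner c n q))
  sign-near-−∞ c zero    1≤c = 0ℚ , λ _ _ → 1≤ι 1≤c
  sign-near-−∞ c (suc n) 1≤c =
    let M , large = sign-near-−∞ (c ∘ suc) n 1≤c
    in M ℚ.⊓ (ℚ.- (1ℚ ℚ.+ ι (c 0))) , λ q q≤ → bound (horner (c ∘ suc) n q)
         (large q (ℚ.≤-trans q≤ (ℚ.p⊓q≤p M (ℚ.- (1ℚ ℚ.+ ι (c 0))))))
         (subst (ℚ._≤ ℚ.- q) (neg-involutive (1ℚ ℚ.+ ι (c 0)))
           (ℚ.neg-antimono-≤ (ℚ.≤-trans q≤ (ℚ.p⊓q≤q M (ℚ.- (1ℚ ℚ.+ ι (c 0)))))))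
    where
    open +-*-Solver
    cancel : ∀ a → ℚ.- a ℚ.+ (1ℚ ℚ.+ a) ℚ.* 1ℚ ≡ 1ℚ
    cancel = solve 1 (λ a → :- a :+ (con 1ℚ :+ a) :* con 1ℚ := con 1ℚ) refl

    -a≤ : ∀ s {a} → 0ℚ ℚ.≤ a → ℚ.- a ℚ.≤ signed s a
    -a≤ Sign.+ 0≤a = ℚ.≤-trans (ℚ.neg-antimono-≤ 0≤a) 0≤a
    -a≤ Sign.- 0≤a = ℚ.≤-refl

    bound : ∀ u {q} → 1ℚ ℚ.≤ signed (σ n) u → 1ℚ ℚ.+ ι (c 0) ℚ.≤ ℚ.- q →
            1ℚ ℚ.≤ signed (σ (suc n)) (ι (c 0) ℚ.+ q ℚ.* u)
    bound u {q} 1≤u ≤-q = begin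
      1ℚ                                                          ≡⟨ cancel (ι (c 0)) ⟨
      ℚ.- ι (c 0) ℚ.+ (1ℚ ℚ.+ ι (c 0)) ℚ.* 1ℚ                     ≤⟨ ℚ.+-mono-≤ (-a≤ (σ (suc n)) (0≤ι (c 0))) (*-monoʳ-≤ (ℚ.nonNegative⁻¹ 1ℚ) ≤-q) ⟩
      signed (σ (suc n)) (ι (c 0)) ℚ.+ ℚ.- q ℚ.* 1ℚ               ≤⟨ ℚ.+-monoʳ-≤ (signed (σ (suc n)) (ι (c 0))) (*-monoˡ-≤ (ℚ.≤-trans 0≤1+a ≤-q) 1≤u) ⟩
      signed (σ (suc n)) (ι (c 0)) ℚ.+ ℚ.- q ℚ.* signed (σ n) u   ≡⟨ cong (signed (σ (suc n)) (ι (c 0)) ℚ.+_) (signed-* Sign.- (σ n) q u) ⟨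
      signed (σ (suc n)) (ι (c 0)) ℚ.+ signed (σ (suc n)) (q ℚ.* u) ≡⟨ signed-+ (σ (suc n)) (ι (c 0)) (q ℚ.* u) ⟨
      signed (σ (suc n)) (ι (c 0) ℚ.+ q ℚ.* u)                    ∎
      where
      open ℚ.≤-Reasoning
      0≤1+a : 0ℚ ℚ.≤ 1ℚ ℚ.+ ι (c 0)
      0≤1+a = 0≤ι (suc (c 0))

  rationally-bounded-below : ∀ x → ∃[ p ] (∀ q → q ℚ.≤ p → fromℚ q < x)
  rationally-bounded-below x =
    let b , 0<b , N , ∣x∣<b = cauchy-bound (cauchy x)
    -- The extra 1 serves as the uniform gap in `_<_`.
    in ℚ.- b ℚ.- 1ℚ , λ q q≤p → 1ℚ , ℚ.positive⁻¹ 1ℚ , N , λ n N≤n → ℚ.≤-<-trans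
         (subst (q ℚ.+ 1ℚ ℚ.≤_) (sym (add-subtract (ℚ.- b) 1ℚ)) (ℚ.+-monoˡ-≤ 1ℚ q≤p))
         (subst (ℚ.- b ℚ.<_) (neg-involutive (seq x n))
           (ℚ.neg-antimono-< (ℚ.≤-<-trans (signed≤∣p∣ Sign.- (seq x n)) (∣x∣<b n N≤n))))

  common-lower-bound : ∀ {n} (ζ : Vector ℝ n) → ∃[ p ] (∀ q → q ℚ.≤ p → ∀ j → fromℚ q < ζ j)
  common-lower-bound {zero}  ζ = 0ℚ , λ _ _ ()
  common-lower-bound {suc n} ζ =
    let p , below-head = rationally-bounded-below (ζ zero)
        r , below-tail = common-lower-bound (tail ζ)
    in p ℚ.⊓ r , λ { q q≤ zero    → below-head q (ℚ.≤-trans q≤ (ℚ.p⊓q≤p p r))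
                   ; q q≤ (suc j) → below-tail q (ℚ.≤-trans q≤ (ℚ.p⊓q≤q p r)) j }

infixl 5 _∷ʳ_

_∷ʳ_ : ∀ {n} → Vector ℝ n → ℝ → Vector ℝ (suc n)
ζ ∷ʳ z = insertAt ζ (fromℕ _) z

∷ʳ-elim : ∀ {n} {ζ : Vector ℝ n} {z} (P : Fin (suc n) → ℝ → Set) →
          (∀ j → P (inject₁ j) (ζ j)) → P (fromℕ n) z → ∀ i → P i ((ζ ∷ʳ z) i)
∷ʳ-elim {zero}  P init last zero    = last
∷ʳ-elim {suc n} P init last zero    = init zero
∷ʳ-elim {suc n} P init last (suc i) = ∷ʳ-elim (P ∘ suc) (init ∘ suc) last i

∷ʳ-inject₁ : ∀ {n} (ζ : Vector ℝ n) z j → (ζ ∷ʳ z) (inject₁ j) ≡ ζ j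
∷ʳ-inject₁ ζ z zero    = refl
∷ʳ-inject₁ ζ z (suc j) = ∷ʳ-inject₁ (tail ζ) z j

∷ʳ-last : ∀ {n} (ζ : Vector ℝ n) z → (ζ ∷ʳ z) (fromℕ n) ≡ z
∷ʳ-last {zero}  ζ z = refl
∷ʳ-last {suc n} ζ z = ∷ʳ-last (tail ζ) z

∷ʳ-increasing : ∀ {n} (ζ : Vector ℝ n) z → Increasing ζ → (∀ j → ζ j < z) → Increasing (ζ ∷ʳ z)
∷ʳ-increasing {suc n} ζ z inc below zero    (suc j) 0<j       =
  ∷ʳ-elim {ζ = tail ζ} {z} (λ _ x → ζ zero < x) (λ k → inc zero (suc k) (s≤s z≤n)) (below zero) j
∷ʳ-increasing {suc n} ζ z inc below (suc i) (suc j) (s≤s i<j) =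
  ∷ʳ-increasing (tail ζ) z (increasing-tail ζ inc) (below ∘ suc) i j i<j

∷-increasing : ∀ {n} y (ζ : Vector ℝ n) → (∀ j → y < ζ j) → Increasing ζ → Increasing (y ∷ ζ)
∷-increasing y ζ above inc zero    (suc j) 0<j       = above j
∷-increasing y ζ above inc (suc i) (suc j) (s≤s i<j) = inc i j i<j

alternating-last : ∀ n → alternating (fromℕ n) ≡ Sign.+
alternating-last zero    = refl
alternating-last (suc n) = alternating-last n

-- `M` stands in for -∞. Between the n + 2 points there are n + 1 gaps, one for each zero of the
-- next polynomial.
enclose : ∀ {n} → ℚ → Vector ℝ n → Vector ℝ (2 ℕ.+ n)
enclose M ζ = fromℚ M ∷ (ζ ∷ʳ 0ℝ)

opaque
  -- Order and signs at the points are strict, so these finitely many conditions survive at a common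
  -- index `N`, whose terms serve as rational endpoints. The result compares the roots with these
  -- terms and not with the original points.
  roots-between : ∀ c n (x : Vector ℝ (2 ℕ.+ n)) → Increasing x →
    (∀ j → HasSign (alternating j) (hornerℝ c (suc n) (x j))) →
    ∃[ N ] ∃[ ξ ] (Increasing (λ j → fromℚ (seq (x j) N)) ×
      StrictlyInterlace ξ (λ j → fromℚ (seq (x j) N)) × (∀ j → hornerℝ c (suc n) (ξ j) ≈ 0ℝ))
  roots-between c n x inc signs = N , proj₁ ∘ root
    , (λ i j i<j → fromℚ-mono-< (ordered i j i<j))
    , (λ j → proj₁ (proj₂ (root j)) , proj₁ (proj₂ (proj₂ (root j))))
    , (λ j → proj₂ (proj₂ (proj₂ (root j))))
    where
    Ordered : ℕ → Set
    Ordered N = ∀ i j → i Fin.< j → seq (x i) N ℚ.< seq (x j) N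

    Signs : ℕ → Set
    Signs N = ∀ j → 0ℚ ℚ.< signed (alternating j) (horner c (suc n) (seq (x j) N))

    eventually-ordered : Eventually Ordered
    eventually-ordered = eventually-∀ (λ i → eventually-∀ (λ j → pair i j))
      where
      pair : ∀ i j → Eventually (λ N → i Fin.< j → seq (x i) N ℚ.< seq (x j) N)
      pair i j with i Fin.<? j
      ... | yes i<j = eventually-map (λ _ lt _ → lt) (<⇒eventually {x i} {x j} (inc i j i<j))
      ... | no  i≮j = 0 , λ _ _ i<j → ⊥-elim (i≮j i<j)

    eventually-signs : Eventually Signs
    eventually-signs = eventually-∀ λ j → let open HasSign (signs j) in eventually-map
      (λ N lt → ℚ.<-trans 0<gap (subst (λ p → gap ℚ.< signed (alternating j) p) (seq-hornerℝ c (suc n) (x j) N) lt))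
      eventual

    sample : Eventually (λ N → Ordered N × Signs N)
    sample = eventually-zip (λ _ → _,_) eventually-ordered eventually-signs

    N : ℕ
    N = proj₁ sample

    q : Fin (2 ℕ.+ n) → ℚ
    q j = seq (x j) N

    ordered : Ordered N
    ordered = proj₁ (proj₂ sample N ℕ.≤-refl)

    root : ∀ j → ∃[ ξ ] (fromℚ (q (inject₁ j)) < ξ × ξ < fromℚ (q (suc j)) × hornerℝ c (suc n) ξ ≈ 0ℝ)
    root j = intermediate-value c n (alternating j)
      (ordered (inject₁ j) (suc j) (s≤s (ℕ.≤-reflexive (Fin.toℕ-inject₁ j))))
      (subst (λ s → 0ℚ ℚ.< signed s (horner c (suc n) (q (inject₁ j)))) (alternating-inject₁ j)
        (proj₂ (proj₂ sample N ℕ.≤-refl) (inject₁ j)))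
      (proj₂ (proj₂ sample N ℕ.≤-refl) (suc j))


  positive⇒sign+ : ∀ {x} → 0ℝ < x → HasSign Sign.+ x
  positive⇒sign+ {x} 0<x = sign-resp-≈ {x = x - 0ℝ} (≡⇒≈ (λ i → sym (p≡p-0 (seq x i)))) (<⇒sign+ {0ℝ} {x} 0<x)

  -- The right side of the recurrence vanishes at `t`, and `t < 0` keeps 1 - t away from 0, so the
  -- weight (1 - t)² of the lower function is strictly positive.
  J-opposite-signs : ∀ m b {t s} → t < 0ℝ → J (suc m) (suc b) t ≈ 0ℝ →
                       HasSign s (J m b t) → HasSign (opposite s) (J (2 ℕ.+ m) (2 ℕ.+ b) t)
  J-opposite-signs m b {t} {s} t<0 J₀≈0 sign₋ =
    let k₊ , k₋ , l , l′ , 0<k₊ , 0<k₋ , recurrence = J′-three-term m b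
        J₋ = J m b t
        J₀ = J (suc m) (suc b) t
        J₊ = J (2 ℕ.+ m) (2 ℕ.+ b) t
        L  = fromℚ l - fromℚ l′ * (1ℝ - t)
        u  = fromℚ k₋ * ((1ℝ - t) * (1ℝ - t))
        three-term : fromℚ k₊ * J₊ + u * J₋ ≈ L * J₀
        three-term = ≡⇒≈ {x = fromℚ k₊ * J₊ + u * J₋} {y = L * J₀} (λ i → trans
          (cong₂ (λ v w → k₊ ℚ.* v ℚ.+ k₋ ℚ.* ((1ℚ ℚ.- seq t i) ℚ.* (1ℚ ℚ.- seq t i)) ℚ.* w)
            (seq-J (2 ℕ.+ m) (2 ℕ.+ b) t i) (seq-J m b t i))
          (trans (recurrence (seq t i))
            (cong ((l ℚ.- l′ ℚ.* (1ℚ ℚ.- seq t i)) ℚ.*_) (sym (seq-J (suc m) (suc b) t i)))))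
        L*J₀≈0 : L * J₀ ≈ 0ℝ
        L*J₀≈0 = ≈-trans (*-cong {x = L} {y = J₀} ≈-refl J₀≈0) (≡⇒≈ {x = L * 0ℝ} (λ i → ℚ.*-zeroʳ (seq L i)))
        1-t : HasSign Sign.+ (1ℝ - t)
        1-t = <⇒sign+ {t} {1ℝ} (<-trans {t} {0ℝ} {1ℝ} t<0 (fromℚ-mono-< (ℚ.positive⁻¹ 1ℚ)))
        sign-u : HasSign Sign.+ u
        sign-u = sign-* {Sign.+} {Sign.+} {fromℚ k₋} (fromℚ-sign {Sign.+} {fromℚ k₋} k₋ 0<k₋ (λ _ → refl))
                   (sign-* {Sign.+} {Sign.+} {1ℝ - t} {1ℝ - t} 1-t 1-t)
    in sign-cancelˡ {opposite s} {Sign.+} {fromℚ k₊} {J₊}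
         (sum-zero⇒opposite-sign {s} {fromℚ k₊ * J₊} {u * J₋} (≈-trans three-term L*J₀≈0)
           (sign-* {Sign.+} {s} {u} {J₋} sign-u sign₋))
         (fromℚ-sign {Sign.+} {fromℚ k₊} k₊ 0<k₊ (λ _ → refl))

  J-sign-at-0 : ∀ A B → HasSign Sign.+ (J A B 0ℝ)
  J-sign-at-0 A B = fromℚ-sign {Sign.+} {J A B 0ℝ} 1ℚ (ℚ.positive⁻¹ 1ℚ) λ i →
    trans (seq-J A B 0ℝ i) (trans (horner-at-0 (coeff A B) A)
      (trans (cong ι (cong₂ ℕ._*_ (nC0≡1 A) (nC0≡1 B))) (ℚ.+-identityʳ 1ℚ)))

  -- `A ≤ B` makes the coefficient C(A, A) C(B, A) of the top power at least 1.
  J-sign-near-−∞ : ∀ A B → A ≤ B → ∃[ M ] (∀ q → q ℚ.≤ M → HasSign (σ A) (J A B (fromℚ q)))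
  J-sign-near-−∞ A B A≤B =
    let M , large = sign-near-−∞ (coeff A B) A (ℕ.*-mono-≤ (1≤nCk (ℕ.≤-refl {A})) (1≤nCk A≤B))
    in M , λ q q≤M → fromℚ-sign {σ A} {J A B (fromℚ q)} (J′ A B q)
         (ℚ.<-≤-trans (ℚ.positive⁻¹ 1ℚ) (large q q≤M)) (seq-J A B (fromℚ q))

-- Induction on the degree

module _ (κ : ℕ) where

  -- The sign is (-1)ⁿ⁻ʲ, since n - j zeros of the next polynomial will turn out to lie above `ζ j`,
  -- with j counted from 0. Every list of zeros is covered because the theorem lets both lists be
  -- arbitrary.
  AlternatesAtZeros : ℕ → Set
  AlternatesAtZeros n = ∀ ζ → IsZeros κ n ζ → ∀ j →
    HasSign (alternating (inject₁ j)) (J (suc n) (suc n ℕ.+ κ) (ζ j))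

  opaque
    enclosure : ∀ n {ζ} → AlternatesAtZeros n → IsZeros κ n ζ →
      ∃[ M ] (Increasing (enclose M ζ) ×
              (∀ j → HasSign (alternating j) (J (suc n) (suc n ℕ.+ κ) (enclose M ζ j))))
    enclosure n {ζ} alternates zeros =
      let K , K-sign  = J-sign-near-−∞ (suc n) (suc n ℕ.+ κ) (ℕ.m≤m+n (suc n) κ)
          L , below-ζ = common-lower-bound (ζ ∷ʳ 0ℝ)
      in K ℚ.⊓ L
       , ∷-increasing (fromℚ (K ℚ.⊓ L)) (ζ ∷ʳ 0ℝ) (below-ζ (K ℚ.⊓ L) (ℚ.p⊓q≤q K L))
           (∷ʳ-increasing ζ 0ℝ (IsZeros.increasing zeros) (IsZeros.negative zeros))
       , λ { zero    → K-sign (K ℚ.⊓ L) (ℚ.p⊓q≤p K L)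
           ; (suc j) → ∷ʳ-elim {ζ = ζ} {0ℝ} (λ i x → HasSign (alternating i) (J (suc n) (suc n ℕ.+ κ) x))
               (alternates ζ zeros)
               (subst (λ s → HasSign s (J (suc n) (suc n ℕ.+ κ) 0ℝ)) (sym (alternating-last n)) (J-sign-at-0 (suc n) (suc n ℕ.+ κ))) j }

    J-sign⇒product-sign : ∀ {n ζ s t} → IsZeros κ n ζ → HasSign s (J n (n ℕ.+ κ) t) →
                          HasSign s (product-of-differences ζ t)
    J-sign⇒product-sign {n} {ζ} {s} {t} zeros J-sign =
      sign-cancelˡ {s} {Sign.+} {lead} {product-of-differences ζ t}
        (sign-resp-≈ (mk≈ (factorisation t)) J-sign) (positive⇒sign+ {lead} lead-positive)
      where open IsZeros zeros

    product-sign⇒J-sign : ∀ {n ζ s t} → IsZeros κ n ζ → HasSign s (product-of-differences ζ t) →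
                          HasSign s (J n (n ℕ.+ κ) t)
    product-sign⇒J-sign {n} {ζ} {s} {t} zeros product-sign =
      sign-resp-≈ (≈-sym (mk≈ (factorisation t)))
        (sign-* {Sign.+} {s} {lead} {product-of-differences ζ t} (positive⇒sign+ {lead} lead-positive) product-sign)
      where open IsZeros zeros

    J-zero : ∀ {n ζ} → IsZeros κ n ζ → ∀ j → J n (n ℕ.+ κ) (ζ j) ≈ 0ℝ
    J-zero {n} {ζ} zeros j = ≈-trans (mk≈ (factorisation (ζ j)))
      (≈-trans (*-cong {x = lead} {y = product-of-differences ζ (ζ j)} ≈-refl (product-root ζ j))
        (≡⇒≈ {x = lead * 0ℝ} (λ i → ℚ.*-zeroʳ (seq lead i))))
      where open IsZeros zeros

    -- By its signs at the enclosing points, the next polynomial has its zeros `ξ` interlacing them.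
    -- Dropping the comparisons with `M` and 0 leaves `ζ` interlacing `ξ`, with the roles of inner
    -- and outer list exchanged.
    interlacing : ∀ n {ζ ξ} → AlternatesAtZeros n → IsZeros κ n ζ → IsZeros κ (suc n) ξ → StrictlyInterlace ζ ξ
    interlacing n {ζ} {ξ} alternates zeros-ζ zeros-ξ j =
      let M , inc , signs = enclosure n alternates zeros-ζ
          inter = signs⇒interlace ξ (enclose M ζ) (IsZeros.increasing zeros-ξ) inc
                    (λ i → J-sign⇒product-sign {t = enclose M ζ i} zeros-ξ (signs i))
      in subst (ξ (inject₁ j) <_) (∷ʳ-inject₁ ζ 0ℝ j) (proj₂ (inter (inject₁ j)))
       , subst (_< ξ (suc j)) (∷ʳ-inject₁ ζ 0ℝ j) (proj₁ (inter (suc j)))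

    zeros-0 : IsZeros κ 0 (λ ())
    zeros-0 = record
      { increasing = λ () ; negative = λ ()
      ; lead = 1ℝ ; lead-positive = fromℚ-mono-< (ℚ.positive⁻¹ 1ℚ)
      ; factorisation = λ t → ≈⇒≃ (≡⇒≈ {x = J 0 κ t} {y = 1ℝ * 1ℝ} (λ i →
          trans (seq-J 0 κ t i) (trans (cong ι (cong (1 ℕ.*_) (nC0≡1 κ))) (ℚ.+-identityʳ 1ℚ))))
      }

    roots⇒zeros : ∀ n ξ (x : Vector ℝ (2 ℕ.+ n)) → Increasing x → x (fromℕ (suc n)) ≡ 0ℝ → StrictlyInterlace ξ x →
      (∀ j → hornerℝ (coeff (suc n) (suc n ℕ.+ κ)) (suc n) (ξ j) ≈ 0ℝ) → IsZeros κ (suc n) ξ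
    roots⇒zeros n ξ x inc last≡0 inter root = record
      { increasing    = inc-ξ
      ; negative      = λ j → subst (ξ j <_) last≡0
          (<-≤-increasing {x = x} {suc j} {fromℕ (suc n)} {ξ j} inc (Fin.≤fromℕ (suc j)) (proj₂ (inter j)))
      ; lead          = fromℚ (ι (c (suc n)))
      ; lead-positive = fromℚ-mono-< (ℚ.<-≤-trans (ℚ.positive⁻¹ 1ℚ)
          (1≤ι (ℕ.*-mono-≤ (1≤nCk (ℕ.≤-refl {suc n})) (1≤nCk (ℕ.m≤m+n (suc n) κ)))))
      ; factorisation = λ t → ≈⇒≃ (≈-trans (J≈hornerℝ (suc n) (suc n ℕ.+ κ) t)
          (factor-theorem (hornerℝ-isPolynomial c (suc n)) ξ inc-ξ root t))
      }
      where
      c : ℕ → ℕ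
      c = coeff (suc n) (suc n ℕ.+ κ)

      inc-ξ : Increasing ξ
      inc-ξ = interlace⇒increasing {ζ = ξ} {x} inc inter

    zeros-suc : ∀ n {ζ} → AlternatesAtZeros n → IsZeros κ n ζ → ∃[ ξ ] IsZeros κ (suc n) ξ
    zeros-suc n {ζ} alternates zeros =
      let M , inc , signs = enclosure n alternates zeros
      in conclude M (roots-between (coeff (suc n) (suc n ℕ.+ κ)) n (enclose M ζ) inc
           (λ j → sign-resp-≈ (J≈hornerℝ (suc n) (suc n ℕ.+ κ) (enclose M ζ j)) (signs j)))
      where
      conclude : ∀ M → ∃[ N ] ∃[ ξ ] (Increasing (λ j → fromℚ (seq (enclose M ζ j) N)) ×
        StrictlyInterlace ξ (λ j → fromℚ (seq (enclose M ζ j) N)) ×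
        (∀ j → hornerℝ (coeff (suc n) (suc n ℕ.+ κ)) (suc n) (ξ j) ≈ 0ℝ)) → ∃[ ξ ] IsZeros κ (suc n) ξ
      conclude M (N , ξ , inc , inter , root) = ξ ,
        roots⇒zeros n ξ (λ j → fromℚ (seq (enclose M ζ j) N)) inc
          -- Sampling does not move the last point, `0ℝ` being a constant sequence; this is what
          -- makes the new zeros negative.
          (cong (λ y → fromℚ (seq y N)) (∷ʳ-last ζ 0ℝ)) inter root

    alternates-suc : ∀ n {η} → AlternatesAtZeros n → IsZeros κ n η → AlternatesAtZeros (suc n)
    alternates-suc n {η} alternates zeros-η ζ zeros-ζ j =
      subst (λ s → HasSign s (J (2 ℕ.+ n) (2 ℕ.+ n ℕ.+ κ) (ζ j))) (sym (alternating-inject₁ j))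
        (J-opposite-signs n (n ℕ.+ κ) {ζ j} (IsZeros.negative zeros-ζ j) (J-zero zeros-ζ j)
          (product-sign⇒J-sign {t = ζ j} zeros-η
            (interlace⇒signs η ζ (IsZeros.increasing zeros-η) (IsZeros.increasing zeros-ζ)
              (interlacing n alternates zeros-η zeros-ζ) j)))

    -- Alternation for `suc n` consumes an actual list of zeros for `n`, and existence for `suc n`
    -- consumes alternation for `n`, so the two advance together.
    zeros-exist-and-alternate : ∀ n → (∃[ ζ ] IsZeros κ n ζ) × AlternatesAtZeros n
    zeros-exist-and-alternate zero    = (_ , zeros-0) , λ _ _ ()
    zeros-exist-and-alternate (suc n) =
      let (ζ , zeros) , alternates = zeros-exist-and-alternate n
      in zeros-suc n alternates zeros , alternates-suc n alternates zeros

corollary4p11 : (κ : ℕ) →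
    (∀ n → 1 ≤ n → ∃[ ζ ] IsZeros κ n ζ) ×
    (∀ n → 1 ≤ n → (ζ : Vector ℝ n) (ξ : Vector ℝ (suc n)) →
    IsZeros κ n ζ → IsZeros κ (suc n) ξ → StrictlyInterlace ζ ξ)
corollary4p11 κ =
  (λ n _ → proj₁ (zeros-exist-and-alternate κ n)) ,
  (λ n _ ζ ξ → interlacing κ n (proj₂ (zeros-exist-and-alternate κ n)))
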